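{- Let $P_{(4,0)}$ be the set of all cylindric partitions with profile $c=(4,0)$. Then, as formal power series in $q$, $$\sum_{\Lambda\in P_{(4,0)}} q^{|\Lambda|}=\left(\sum_{n\ge0}\frac{q^{n(n+1)}(-q^2;q^2)_n}{(-q^3;q^2)_n\,(q^2;q^2)_n}\right)\frac{(-q^3;q^2)_\infty}{(q;q)_\infty}.$$
   Context: Let $r,\ell$ be positive integers and $c=(c_1,\dots,c_r)$ a composition of $\ell$ into $r$ nonnegative integer parts (zero entries allowed). A cylindric partition with profile $c$ is a tuple $\Lambda=(\lambda^{(1)},\dots,\lambda^{(r)})$ of ordinary partitions $\lambda^{(i)}=(\lambda^{(i)}_1\ge\lambda^{(i)}_2\ge\cdots)$ (parts beyond the length are taken to be $0$) such that for all $i,j$: $\lambda^{(i)}_j\ge\lambda^{(i+1)}_{j+c_{i+1}}$ for $1\le i\le r-1$, and $\lambda^{(r)}_j\ge\lambda^{(1)}_{j+c_1}$. The size $|\Lambda|$ is the sum of all parts of all $\lambda^{(i)}$; the empty cylindric partition is included with size $0$. Notation: $(a;q)_n=\prod_{k=1}^n(1-aq^{k-1})$, $(a;q)_\infty=\lim_{n\to\infty}(a;q)_n$. -}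

module Defs where

open import Data.Nat using (ℕ; zero; suc; _≤_; _<_; _≡ᵇ_) renaming (_+_ to _+ℕ_; _*_ to _*ℕ_)
open import Data.Nat.DivMod using (_/_; _%_)
open import Data.Integer using (ℤ; +_; -_; _+_; _*_; _^_; 0ℤ; 1ℤ)
open import Data.List using (List; []; _∷_; map; upTo; foldr)
open import Data.Nat.ListAction using (sum)
open import Data.List.Relation.Unary.All using (All)
open import Data.Bool using (if_then_else_)
open import Data.Product using (_×_)

-- j-th part (0-based) of a partition given as the list of its nonzero
-- parts; parts beyond the length are 0.
part : List ℕ → ℕ → ℕ
part []       _       = 0
part (x ∷ _)  zero    = x
part (_ ∷ xs) (suc j) = part xs j

IsPartition : List ℕ → Set
IsPartition l = All (λ x → 0 < x) l × (∀ j → part l (suc j) ≤ part l j)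

-- Cylindric partition with profile c = (c₁ , c₂) (r = 2, ℓ = c₁ + c₂):
--   λ⁽¹⁾_j ≥ λ⁽²⁾_{j+c₂}   and   λ⁽²⁾_j ≥ λ⁽¹⁾_{j+c₁}   for all j.
-- Proof fields are irrelevant, so a cylindric partition is determined by
-- its two partitions.
record CylindricPartition (c₁ c₂ : ℕ) : Set where
  constructor cyl
  field
    λ¹ λ² : List ℕ
    .isPart¹ : IsPartition λ¹
    .isPart² : IsPartition λ²
    .cond₁   : ∀ j → part λ² (j +ℕ c₂) ≤ part λ¹ j
    .cond₂   : ∀ j → part λ¹ (j +ℕ c₁) ≤ part λ² j

size : ∀ {c₁ c₂} → CylindricPartition c₁ c₂ → ℕ
size Λ = sum (CylindricPartition.λ¹ Λ) +ℕ sum (CylindricPartition.λ² Λ)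

Series : Set
Series = ℕ → ℤ

oneS : Series
oneS zero    = 1ℤ
oneS (suc _) = 0ℤ

monoS : ℕ → Series
monoS k n = if k ≡ᵇ n then 1ℤ else 0ℤ

_+S_ : Series → Series → Series
(f +S g) n = f n + g n

_⊛_ : Series → Series → Series
(f ⊛ g) n = foldr _+_ 0ℤ (map (λ k → f k * g (n Data.Nat.∸ k)) (upTo (suc n)))

sumS : List Series → Series
sumS = foldr _+S_ (λ _ → 0ℤ)

prodS : List Series → Series
prodS = foldr _⊛_ oneS

factor : ℤ → ℕ → Series
factor ε e = oneS +S (λ n → - (ε * monoS e n))

-- (1 - ε q^(suc e))⁻¹ = Σ_m ε^m q^(m·(suc e))  (the inverse in ℤ[[q]])
invFactor : ℤ → ℕ → Series
invFactor ε e n = if (n % suc e) ≡ᵇ 0 then ε ^ (n / suc e) else 0ℤ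

poch : ℤ → ℕ → ℕ → ℕ → Series
poch ε s d n = prodS (map (λ k → factor ε (s +ℕ d *ℕ k)) (upTo n))

-- 1 / (ε q^(suc s) ; q^d)_n = Π_{k<n} (1 - ε q^(suc s + d k))⁻¹
invPoch : ℤ → ℕ → ℕ → ℕ → Series
invPoch ε s d n = prodS (map (λ k → invFactor ε (s +ℕ d *ℕ k)) (upTo n))

summand : ℕ → Series
summand n = monoS (n *ℕ suc n)
          ⊛ (poch (- 1ℤ) 2 2 n ⊛ (invPoch (- 1ℤ) 2 2 n ⊛ invPoch 1ℤ 1 2 n))

-- Coefficient of q^N in
--   (Σ_{n≥0} summand n) · (-q³;q²)_∞ / (q;q)_∞ .
-- Infinite sums/products are formal limits; for the coefficient of q^N only
-- the summands n ≤ N (summand n = O(q^{n(n+1)})) and the factors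
-- (1+q^{2k+3}), k < N+1, and (1-q^{k+1})⁻¹, k < N+1, contribute, so the
-- coefficient equals that of the truncation below.
rhsCoeff : ℕ → ℤ
rhsCoeff N =
  (sumS (map summand (upTo (suc N)))
    ⊛ (poch (- 1ℤ) 3 2 (suc N) ⊛ invPoch 1ℤ 0 1 (suc N))) N

{-# OPTIONS --safe #-}

-- Let X(a,b) be the generating function of the cylindric partitions whose rows have fewer than a resp. b
-- parts.  Subtracting 1 from every part of those with exactly a resp. b parts gives, for 0 ≤ a - b ≤ 4,
--   (1 - q^(a+b)) X(a+1,b+1) = X(a,b+1) + X(a+1,b) - X(a,b)   (a + b > 0).
-- Multiplied by (q;q)_(2i+2), the series X(i+2,i+2), X(i+3,i+1), X(i+4,i) become A_i, B_i, C_i with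
--   A_(i+1) = q^(2i+2) A_i + B_i,   C_(i+1) = q^(2i+2) C_i + B_i,
--   B_(i+1) = (1 + q^(2i+3)) B_i + q^(2i+2) (A_i + C_i),   (A_0, B_0, C_0) = (1, 1, 0).
-- On the other side, put  α(y) = Σ_n y^n q^(n(n+1)) (-q²;q²)_n (-y q^(2n+3);q²)_∞ / (q²;q²)_n, so that the
-- right-hand side of the theorem is α(1)/(q;q)_∞.  Telescoping gives
--   α(y/q²) = (1 + y + yq) α(y) + y q² (1 - yq) α(q²y),
-- which is the transposed recursion.  Hence, with α_k = α(q^(2k)) and γ_k = α_k - q^(2k+2) α_(k+1),
--   q^(2i+2) α_(i+1) (A_i + C_i) + γ_i B_i
-- does not depend on i; it is α(1) for i = 0 and tends to lim B_i = lim A_i as i → ∞.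
-- All limits are taken by computing modulo q^K with K = N + 1.

module Submission where

open import Defs
open import Data.Nat using (ℕ)
open import Data.Integer using (+_)
open import Data.Fin using (Fin)
open import Data.Product using (Σ; ∃; _×_)
open import Function.Bundles using (_↔_)
open import Relation.Binary.PropositionalEquality using (_≡_)

open import Algebra.Bundles using (CommutativeRing)
import Algebra.Properties.Ring
import Algebra.Solver.Ring
open import Algebra.Solver.Ring.AlmostCommutativeRing using (fromCommutativeRing; _-Raw-AlmostCommutative⟶_)
open import Data.Bool.Base using (true; false; if_then_else_)
open import Data.Empty using (⊥-elim-irr)
open import Data.Fin.Base using (zero)
open import Data.Fin.Permutation using (↔⇒≡)
open import Data.Fin.Properties using (+↔⊎)
open import Data.Integer using (ℤ; 0ℤ; 1ℤ; +-*-rawRing)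
import Data.Integer.Properties as ℤ
open import Data.Integer.Solver using () renaming (module +-*-Solver to ℤ-Solver)
open import Data.Irrelevant using ([_])
open import Data.List.Base using (List; []; _∷_; _∷ʳ_; map; foldr; length; upTo)
import Data.List.Properties as List
open import Data.List.Relation.Unary.All using (All; []; _∷_)
open import Data.Maybe.Base using (Maybe; just; nothing)
open import Data.Nat.Base as ℕ using (zero; suc; pred; _<_; _≤_; s≤s; z≤n; z<s; >-nonZero)
import Data.Nat.Divisibility as ℕ
import Data.Nat.DivMod as ℕ
open import Data.Nat.Induction using (Acc; acc; <-wellFounded)
open import Data.Nat.ListAction using (sum)
import Data.Nat.Properties as ℕ
open import Data.Nat.Solver using () renaming (module +-*-Solver to ℕ-Solver)
open import Data.Product.Base using (_,_; proj₁; proj₂)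
open import Data.Product.Properties using (≡-dec)
open import Data.Refinement using (Refinement; _,_; value-injective)
open import Data.Sum.Base using (_⊎_; inj₁; inj₂)
open import Data.Sum.Function.Propositional using (_⊎-↔_)
open import Function.Base using (_∘_)
open import Function.Bundles using (mk↔ₛ′)
open import Function.Properties.Inverse using (↔-sym; ↔-trans; ↔-refl)
open import Level using (0ℓ)
open import Relation.Binary.Definitions using (DecidableEquality)
import Relation.Binary.PropositionalEquality as ≡
import Relation.Binary.Reasoning.Setoid
open import Relation.Nullary using (Dec; yes; no; ¬_; contradiction; contradiction-irr)
open import Relation.Nullary.Decidable using (recompute; _×-dec_)

-- The ring of power series modulo q^K

module PowerSeries where
  open import Data.Integer using (-_; _+_; _*_; _^_)
  open ≡

  -- The Cauchy product, coefficient by coefficient.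

  ⊛-zero : ∀ f g → (f ⊛ g) 0 ≡ f 0 * g 0
  ⊛-zero f g = ℤ.+-identityʳ _

  -- Splitting off the summand k = 0 leaves a product with the shifted series `f ∘ suc`. This
  -- recursion drives the inductive proofs of the ring laws below.
  ⊛-suc : ∀ f g n → (f ⊛ g) (suc n) ≡ f 0 * g (suc n) + ((f ∘ suc) ⊛ g) n
  ⊛-suc f g n = cong (λ ts → f 0 * g (suc n) + foldr _+_ 0ℤ ts)
    (trans (List.map-applyUpTo suc h (suc n)) (sym (List.map-upTo (h ∘ suc) (suc n))))
    where
    h : ℕ → ℤ
    h k = f k * g (suc n ℕ.∸ k)

  -- Coefficient n of a product involves only coefficients up to n of its factors; hence
  -- multiplication is well defined modulo q^K.
  ⊛-cong-≤ : ∀ {f f′ g g′} n → (∀ k → k ≤ n → f k ≡ f′ k) → (∀ k → k ≤ n → g k ≡ g′ k) →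
             (f ⊛ g) n ≡ (f′ ⊛ g′) n
  ⊛-cong-≤ {f} {f′} {g} {g′} zero p r = begin
    (f ⊛ g) 0     ≡⟨ ⊛-zero f g ⟩
    f 0 * g 0     ≡⟨ cong₂ _*_ (p 0 z≤n) (r 0 z≤n) ⟩
    f′ 0 * g′ 0   ≡⟨ ⊛-zero f′ g′ ⟨
    (f′ ⊛ g′) 0   ∎
    where open ≡-Reasoning
  ⊛-cong-≤ {f} {f′} {g} {g′} (suc n) p r = begin
    (f ⊛ g) (suc n)                             ≡⟨ ⊛-suc f g n ⟩
    f 0 * g (suc n) + ((f ∘ suc) ⊛ g) n         ≡⟨ cong₂ _+_ (cong₂ _*_ (p 0 z≤n) (r (suc n) ℕ.≤-refl))
                                                    (⊛-cong-≤ n (λ k k≤n → p (suc k) (s≤s k≤n))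
                                                               (λ k k≤n → r k (ℕ.m≤n⇒m≤1+n k≤n))) ⟩
    f′ 0 * g′ (suc n) + ((f′ ∘ suc) ⊛ g′) n     ≡⟨ ⊛-suc f′ g′ n ⟨
    (f′ ⊛ g′) (suc n)                           ∎
    where open ≡-Reasoning

  ⊛-congʳ : ∀ g {f f′} → f ≗ f′ → (f ⊛ g) ≗ (f′ ⊛ g)
  ⊛-congʳ g p n = ⊛-cong-≤ {g = g} n (λ k _ → p k) (λ _ _ → refl)

  const : ℤ → Series
  const c zero    = c
  const c (suc _) = 0ℤ

  0-⊛ : ∀ g → ((λ _ → 0ℤ) ⊛ g) ≗ (λ _ → 0ℤ)
  0-⊛ g zero    = ⊛-zero (λ _ → 0ℤ) g
  0-⊛ g (suc n) = trans (⊛-suc (λ _ → 0ℤ) g n) (cong (_+_ 0ℤ) (0-⊛ g n))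

  const-⊛ : ∀ c g → (const c ⊛ g) ≗ (λ n → c * g n)
  const-⊛ c g zero    = ⊛-zero (const c) g
  const-⊛ c g (suc n) = trans (⊛-suc (const c) g n) (trans (cong (_+_ (c * g (suc n))) (0-⊛ g n)) (ℤ.+-identityʳ _))

  oneS≗const : oneS ≗ const 1ℤ
  oneS≗const zero    = refl
  oneS≗const (suc _) = refl

  ⊛-distribʳ-+ : ∀ h f g → ((f +S g) ⊛ h) ≗ ((f ⊛ h) +S (g ⊛ h))
  ⊛-distribʳ-+ h f g zero = trans (⊛-zero (f +S g) h)
    (trans (ℤ.*-distribʳ-+ (h 0) (f 0) (g 0)) (sym (cong₂ _+_ (⊛-zero f h) (⊛-zero g h))))
  ⊛-distribʳ-+ h f g (suc n) = begin
    ((f +S g) ⊛ h) (suc n)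
      ≡⟨ ⊛-suc (f +S g) h n ⟩
    (f 0 + g 0) * h (suc n) + (((f ∘ suc) +S (g ∘ suc)) ⊛ h) n
      ≡⟨ cong (_+_ ((f 0 + g 0) * h (suc n))) (⊛-distribʳ-+ h (f ∘ suc) (g ∘ suc) n) ⟩
    (f 0 + g 0) * h (suc n) + (((f ∘ suc) ⊛ h) n + ((g ∘ suc) ⊛ h) n)
      ≡⟨ solve 5 (λ a b c d e → (a :+ b) :* c :+ (d :+ e) := (a :* c :+ d) :+ (b :* c :+ e)) refl
           (f 0) (g 0) (h (suc n)) _ _ ⟩
    (f 0 * h (suc n) + ((f ∘ suc) ⊛ h) n) + (g 0 * h (suc n) + ((g ∘ suc) ⊛ h) n)
      ≡⟨ cong₂ _+_ (⊛-suc f h n) (⊛-suc g h n) ⟨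
    ((f ⊛ h) +S (g ⊛ h)) (suc n) ∎
    where
    open ≡-Reasoning
    open ℤ-Solver

  scale-⊛ : ∀ c f g → ((λ n → c * f n) ⊛ g) ≗ (λ n → c * (f ⊛ g) n)
  scale-⊛ c f g zero = trans (⊛-zero (λ n → c * f n) g)
    (trans (ℤ.*-assoc c (f 0) (g 0)) (cong (c *_) (sym (⊛-zero f g))))
  scale-⊛ c f g (suc n) = begin
    ((λ n → c * f n) ⊛ g) (suc n)                           ≡⟨ ⊛-suc (λ n → c * f n) g n ⟩
    c * f 0 * g (suc n) + ((λ n → c * f (suc n)) ⊛ g) n     ≡⟨ cong (_+_ (c * f 0 * g (suc n))) (scale-⊛ c (f ∘ suc) g n) ⟩
    c * f 0 * g (suc n) + c * ((f ∘ suc) ⊛ g) n             ≡⟨ solve 4 (λ a b d e → a :* b :* d :+ a :* e := a :* (b :* d :+ e))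
                                                                refl c (f 0) (g (suc n)) _ ⟩
    c * (f 0 * g (suc n) + ((f ∘ suc) ⊛ g) n)               ≡⟨ cong (c *_) (⊛-suc f g n) ⟨
    c * (f ⊛ g) (suc n)                                     ∎
    where
    open ≡-Reasoning
    open ℤ-Solver

  -- The mirror image of `⊛-suc`, splitting off the last summand; commutativity follows by playing
  -- one against the other.
  ⊛-sucʳ : ∀ f g n → (f ⊛ g) (suc n) ≡ (f ⊛ (g ∘ suc)) n + f (suc n) * g 0
  ⊛-sucʳ f g zero = trans (⊛-suc f g 0) (cong₂ _+_ (sym (⊛-zero f (g ∘ suc))) (⊛-zero (f ∘ suc) g))
  ⊛-sucʳ f g (suc n) = begin
    (f ⊛ g) (suc (suc n))
      ≡⟨ ⊛-suc f g (suc n) ⟩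
    f 0 * g (suc (suc n)) + ((f ∘ suc) ⊛ g) (suc n)
      ≡⟨ cong (_+_ (f 0 * g (suc (suc n)))) (⊛-sucʳ (f ∘ suc) g n) ⟩
    f 0 * g (suc (suc n)) + (((f ∘ suc) ⊛ (g ∘ suc)) n + f (suc (suc n)) * g 0)
      ≡⟨ ℤ.+-assoc (f 0 * g (suc (suc n))) _ _ ⟨
    f 0 * g (suc (suc n)) + ((f ∘ suc) ⊛ (g ∘ suc)) n + f (suc (suc n)) * g 0
      ≡⟨ cong (_+ f (suc (suc n)) * g 0) (⊛-suc f (g ∘ suc) n) ⟨
    (f ⊛ (g ∘ suc)) (suc n) + f (suc (suc n)) * g 0 ∎
    where open ≡-Reasoning

  ⊛-comm : ∀ f g → (f ⊛ g) ≗ (g ⊛ f)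
  ⊛-comm f g zero    = trans (⊛-zero f g) (trans (ℤ.*-comm (f 0) (g 0)) (sym (⊛-zero g f)))
  ⊛-comm f g (suc n) = begin
    (f ⊛ g) (suc n)                          ≡⟨ ⊛-suc f g n ⟩
    f 0 * g (suc n) + ((f ∘ suc) ⊛ g) n      ≡⟨ cong₂ _+_ (ℤ.*-comm (f 0) _) (⊛-comm (f ∘ suc) g n) ⟩
    g (suc n) * f 0 + (g ⊛ (f ∘ suc)) n      ≡⟨ ℤ.+-comm (g (suc n) * f 0) _ ⟩
    (g ⊛ (f ∘ suc)) n + g (suc n) * f 0      ≡⟨ ⊛-sucʳ g f n ⟨
    (g ⊛ f) (suc n)                          ∎
    where open ≡-Reasoning

  ⊛-assoc : ∀ f g h → ((f ⊛ g) ⊛ h) ≗ (f ⊛ (g ⊛ h))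
  ⊛-assoc f g h zero = begin
    ((f ⊛ g) ⊛ h) 0      ≡⟨ ⊛-zero (f ⊛ g) h ⟩
    (f ⊛ g) 0 * h 0      ≡⟨ cong (_* h 0) (⊛-zero f g) ⟩
    f 0 * g 0 * h 0      ≡⟨ ℤ.*-assoc (f 0) (g 0) (h 0) ⟩
    f 0 * (g 0 * h 0)    ≡⟨ cong (f 0 *_) (⊛-zero g h) ⟨
    f 0 * (g ⊛ h) 0      ≡⟨ ⊛-zero f (g ⊛ h) ⟨
    (f ⊛ (g ⊛ h)) 0      ∎
    where open ≡-Reasoning
  ⊛-assoc f g h (suc n) = begin
    ((f ⊛ g) ⊛ h) (suc n)
      ≡⟨ ⊛-suc (f ⊛ g) h n ⟩
    (f ⊛ g) 0 * h (suc n) + (((f ⊛ g) ∘ suc) ⊛ h) n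
      ≡⟨ cong₂ _+_ (cong (_* h (suc n)) (⊛-zero f g)) (⊛-congʳ h (⊛-suc f g) n) ⟩
    f 0 * g 0 * h (suc n) + (((λ k → f 0 * g (suc k)) +S ((f ∘ suc) ⊛ g)) ⊛ h) n
      ≡⟨ cong (_+_ (f 0 * g 0 * h (suc n))) (⊛-distribʳ-+ h (λ k → f 0 * g (suc k)) ((f ∘ suc) ⊛ g) n) ⟩
    f 0 * g 0 * h (suc n) + (((λ k → f 0 * g (suc k)) ⊛ h) n + (((f ∘ suc) ⊛ g) ⊛ h) n)
      ≡⟨ cong (_+_ (f 0 * g 0 * h (suc n))) (cong₂ _+_ (scale-⊛ (f 0) (g ∘ suc) h n) (⊛-assoc (f ∘ suc) g h n)) ⟩
    f 0 * g 0 * h (suc n) + (f 0 * ((g ∘ suc) ⊛ h) n + ((f ∘ suc) ⊛ (g ⊛ h)) n)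
      ≡⟨ solve 5 (λ a b c d e → a :* b :* c :+ (a :* d :+ e) := a :* (b :* c :+ d) :+ e) refl
           (f 0) (g 0) (h (suc n)) _ _ ⟩
    f 0 * (g 0 * h (suc n) + ((g ∘ suc) ⊛ h) n) + ((f ∘ suc) ⊛ (g ⊛ h)) n
      ≡⟨ cong (λ z → f 0 * z + ((f ∘ suc) ⊛ (g ⊛ h)) n) (⊛-suc g h n) ⟨
    f 0 * (g ⊛ h) (suc n) + ((f ∘ suc) ⊛ (g ⊛ h)) n
      ≡⟨ ⊛-suc f (g ⊛ h) n ⟨
    (f ⊛ (g ⊛ h)) (suc n) ∎
    where
    open ≡-Reasoning
    open ℤ-Solver

  ⊛-identityˡ : ∀ f → (oneS ⊛ f) ≗ f
  ⊛-identityˡ f n = trans (⊛-congʳ f oneS≗const n) (trans (const-⊛ 1ℤ f n) (ℤ.*-identityˡ (f n)))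

  -- Multiplication by q^k as a shift.

  monoS-⊛-< : ∀ k f n → n < k → (monoS k ⊛ f) n ≡ 0ℤ
  monoS-⊛-< (suc k) f zero    _         = ⊛-zero (monoS (suc k)) f
  monoS-⊛-< (suc k) f (suc n) (s≤s n<k) =
    trans (⊛-suc (monoS (suc k)) f n) (trans (ℤ.+-identityˡ _) (monoS-⊛-< k f n n<k))

  monoS0≗oneS : monoS 0 ≗ oneS
  monoS0≗oneS zero    = refl
  monoS0≗oneS (suc _) = refl

  -- Degrees from k on are written as k + n, which avoids subtraction; lower degrees fall under
  -- `monoS-⊛-<`.
  monoS-⊛-+ : ∀ k f n → (monoS k ⊛ f) (k ℕ.+ n) ≡ f n
  monoS-⊛-+ zero    f n = trans (⊛-congʳ f monoS0≗oneS n) (⊛-identityˡ f n)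
  monoS-⊛-+ (suc k) f n =
    trans (⊛-suc (monoS (suc k)) f (k ℕ.+ n)) (trans (ℤ.+-identityˡ _) (monoS-⊛-+ k f n))

  monoS-< : ∀ k n → n < k → monoS k n ≡ 0ℤ
  monoS-< (suc k) zero    _         = refl
  monoS-< (suc k) (suc n) (s≤s n<k) = monoS-< k n n<k

  monoS-homo : ∀ k l → monoS (k ℕ.+ l) ≗ (monoS k ⊛ monoS l)
  monoS-homo k l n with n ℕ.<? k
  ... | yes n<k = trans (monoS-< (k ℕ.+ l) n (ℕ.≤-trans n<k (ℕ.m≤m+n k l))) (sym (monoS-⊛-< k (monoS l) n n<k))
  ... | no  n≮k with ℕ.≮⇒≥ n≮k
  ...   | k≤n with ℕ.m≤n⇒∃[o]m+o≡n k≤n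
  ...     | m , refl = trans (shift k) (sym (monoS-⊛-+ k (monoS l) m))
    where
    shift : ∀ k → monoS (k ℕ.+ l) (k ℕ.+ m) ≡ monoS l m
    shift zero    = refl
    shift (suc k) = shift k

  -- Congruence modulo q^K and the ring it defines.

  record _≈[_]_ (f : Series) (K : ℕ) (g : Series) : Set where
    constructor mod
    field
      coeff : ∀ {n} → n < K → f n ≡ g n

  open _≈[_]_ public

  ≗⇒≈ : ∀ {f g K} → f ≗ g → f ≈[ K ] g
  ≗⇒≈ p = mod λ {n} _ → p n

  -- This is ℤ[[q]]/(q^K) with all series as carrier: only equality is truncated, so an equation in
  -- it still speaks about the original coefficients below K.
  truncatedRing : ℕ → CommutativeRing 0ℓ 0ℓ
  truncatedRing K = record
    { Carrier = Series
    ; _≈_ = _≈[ K ]_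
    ; _+_ = _+S_
    ; _*_ = _⊛_
    ; -_ = λ f n → - f n
    ; 0# = λ _ → 0ℤ
    ; 1# = oneS
    ; isCommutativeRing = record
      { isRing = record
        { +-isAbelianGroup = record
          { isGroup = record
            { isMonoid = record
              { isSemigroup = record
                { isMagma = record
                  { isEquivalence = record
                    { refl = mod λ _ → refl
                    ; sym = λ p → mod λ n<K → sym (coeff p n<K)
                    ; trans = λ p r → mod λ n<K → trans (coeff p n<K) (coeff r n<K)
                    }
                  ; ∙-cong = λ p r → mod λ n<K → cong₂ _+_ (coeff p n<K) (coeff r n<K)
                  }
                ; assoc = λ f g h → mod λ {n} _ → ℤ.+-assoc (f n) (g n) (h n)
                }
              ; identity = (λ f → mod λ {n} _ → ℤ.+-identityˡ (f n))
                         , (λ f → mod λ {n} _ → ℤ.+-identityʳ (f n))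
              }
            ; inverse = (λ f → mod λ {n} _ → ℤ.+-inverseˡ (f n))
                      , (λ f → mod λ {n} _ → ℤ.+-inverseʳ (f n))
            ; ⁻¹-cong = λ p → mod λ n<K → cong -_ (coeff p n<K)
            }
          ; comm = λ f g → mod λ {n} _ → ℤ.+-comm (f n) (g n)
          }
        ; *-cong = λ {f} {f′} {g} {g′} p r → mod λ {n} n<K → ⊛-cong-≤ {f} {f′} {g} {g′} n
                     (λ k k≤n → coeff p (ℕ.≤-<-trans k≤n n<K))
                     (λ k k≤n → coeff r (ℕ.≤-<-trans k≤n n<K))
        ; *-assoc = λ f g h → ≗⇒≈ (⊛-assoc f g h)
        ; *-identity = (λ f → ≗⇒≈ (⊛-identityˡ f))
                     , (λ f → ≗⇒≈ λ n → trans (⊛-comm f oneS n) (⊛-identityˡ f n))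
        ; distrib = (λ f g h → ≗⇒≈ λ n → trans (⊛-comm f (g +S h) n)
                       (trans (⊛-distribʳ-+ f g h n) (cong₂ _+_ (⊛-comm g f n) (⊛-comm h f n))))
                  , (λ h f g → ≗⇒≈ (⊛-distribʳ-+ h f g))
        }
      ; *-comm = λ f g → ≗⇒≈ (⊛-comm f g)
      }
    }

  -- Integers as coefficients give the ring solver a decidable equality, which series do not have.
  constHom : ∀ K → +-*-rawRing -Raw-AlmostCommutative⟶ fromCommutativeRing (truncatedRing K)
  constHom K = record
    { ⟦_⟧    = const
    ; +-homo = λ a b → ≗⇒≈ λ { zero → refl ; (suc _) → refl }
    ; *-homo = λ a b → ≗⇒≈ λ n → trans (scale a b n) (sym (const-⊛ a (const b) n))
    ; -‿homo = λ a → ≗⇒≈ λ { zero → refl ; (suc _) → refl }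
    ; 0-homo = ≗⇒≈ λ { zero → refl ; (suc _) → refl }
    ; 1-homo = ≗⇒≈ λ { zero → refl ; (suc _) → refl }
    }
    where
    scale : ∀ a b → const (a * b) ≗ (λ n → a * const b n)
    scale a b zero    = refl
    scale a b (suc _) = sym (ℤ.*-zeroʳ a)

  -- With d = e + 1, the geometric series g agrees with 1 below degree d and satisfies g(d + m) = ε
  -- g(m); so the shifted copy subtracted by the factor cancels everything but the constant term.
  factor-⊛-invFactor : ∀ ε e → (factor ε (suc e) ⊛ invFactor ε e) ≗ oneS
  factor-⊛-invFactor ε e n = begin
    (factor ε d ⊛ g) n
      ≡⟨ ⊛-distribʳ-+ g oneS (λ k → - (ε * monoS d k)) n ⟩
    (oneS ⊛ g) n + ((λ k → - (ε * monoS d k)) ⊛ g) n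
      ≡⟨ cong₂ _+_ (⊛-identityˡ g n) (⊛-congʳ g (λ k → ℤ.neg-distribˡ-* ε (monoS d k)) n) ⟩
    g n + ((λ k → - ε * monoS d k) ⊛ g) n
      ≡⟨ cong (_+_ (g n)) (scale-⊛ (- ε) (monoS d) g n) ⟩
    g n + - ε * (monoS d ⊛ g) n
      ≡⟨ shifted n ⟩
    oneS n ∎
    where
    open ≡-Reasoning
    open ℤ-Solver
    d = suc e
    g = invFactor ε e

    g-+ : ∀ m → g (d ℕ.+ m) ≡ ε * g m
    g-+ m = trans (cong₂ (λ r k → if r ℕ.≡ᵇ 0 then ε ^ k else 0ℤ) %-d+ /-d+) (lemma (m ℕ.% d ℕ.≡ᵇ 0))
      where
      %-d+ : (d ℕ.+ m) ℕ.% d ≡ m ℕ.% d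
      %-d+ = trans (cong (ℕ._% d) (ℕ.+-comm d m)) (ℕ.[m+n]%n≡m%n m d)
      /-d+ : (d ℕ.+ m) ℕ./ d ≡ suc (m ℕ./ d)
      /-d+ = trans (ℕ.+-distrib-/-∣ˡ m ℕ.∣-refl) (cong (ℕ._+ m ℕ./ d) (ℕ.n/n≡1 d))
      lemma : ∀ b → (if b then ε ^ suc (m ℕ./ d) else 0ℤ) ≡ ε * (if b then ε ^ (m ℕ./ d) else 0ℤ)
      lemma true  = refl
      lemma false = sym (ℤ.*-zeroʳ ε)

    g-< : ∀ n → n < d → g n ≡ oneS n
    g-< zero    _   = refl
    g-< (suc n) n<d = cong (λ r → if r ℕ.≡ᵇ 0 then ε ^ (suc n ℕ./ d) else 0ℤ) (ℕ.m<n⇒m%n≡m n<d)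

    shifted : ∀ n → g n + - ε * (monoS d ⊛ g) n ≡ oneS n
    shifted n with n ℕ.<? d
    ... | yes n<d = trans (cong₂ (λ u v → u + - ε * v) (g-< n n<d) (monoS-⊛-< d g n n<d))
                          (trans (cong (_+_ (oneS n)) (ℤ.*-zeroʳ (- ε))) (ℤ.+-identityʳ _))
    ... | no n≮d with ℕ.m≤n⇒∃[o]m+o≡n (ℕ.≮⇒≥ n≮d)
    ...   | m , refl = begin
      g (d ℕ.+ m) + - ε * (monoS d ⊛ g) (d ℕ.+ m)   ≡⟨ cong₂ (λ u v → u + - ε * v) (g-+ m) (monoS-⊛-+ d g m) ⟩
      ε * g m + - ε * g m                           ≡⟨ solve 2 (λ a b → a :* b :+ (:- a) :* b := con 0ℤ) refl ε (g m) ⟩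
      0ℤ                                            ∎

-- The q-series identity

-- The properties of q from which the identity is derived. `q^-≥` makes q nilpotent, so infinite
-- products become finite; `inv⁺ e` and `inv⁻ e` invert the factors of exponent e + 1, following the
-- convention of `invFactor`.
record QFactors (R : CommutativeRing 0ℓ 0ℓ) (K : ℕ) : Set where
  open CommutativeRing R
  field
    q^ fac⁺ fac⁻ inv⁺ inv⁻ : ℕ → Carrier
    q^0       : q^ 0 ≈ 1#
    q^-+      : ∀ k l → q^ (k ℕ.+ l) ≈ q^ k * q^ l
    q^-≥      : ∀ {e} → K ≤ e → q^ e ≈ 0#
    fac⁺≈     : ∀ e → fac⁺ e ≈ 1# + q^ e
    fac⁻≈     : ∀ e → fac⁻ e ≈ 1# - q^ e
    fac⁺-inv⁺ : ∀ e → fac⁺ (suc e) * inv⁺ e ≈ 1#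
    fac⁻-inv⁻ : ∀ e → fac⁻ (suc e) * inv⁻ e ≈ 1#

module QSeries
  (R : CommutativeRing 0ℓ 0ℓ)
  (hom : +-*-rawRing -Raw-AlmostCommutative⟶ fromCommutativeRing R)
  (K : ℕ) (Q : QFactors R K)
  where

  open CommutativeRing R
  open QFactors Q
  open ℕ-Solver using () renaming (solve to solveℕ; con to κ; _:+_ to _⊕_; _:*_ to _⊗_; _:=_ to _⊜_)
  open Algebra.Properties.Ring ring using (-0#≈0#)
  open Relation.Binary.Reasoning.Setoid setoid
  open _-Raw-AlmostCommutative⟶_ hom using (1-homo) renaming (⟦_⟧ to ι)

  private
    coeff≟ : ∀ a b → Maybe (ι a ≈ ι b)
    coeff≟ a b with a ℤ.≟ b
    ... | yes ≡.refl = just refl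
    ... | no _       = nothing

  open Algebra.Solver.Ring +-*-rawRing (fromCommutativeRing R) hom coeff≟

  -- The ring solver has no other name for 1 than the image of the coefficient 1.
  𝟙 : Carrier
  𝟙 = ι 1ℤ

  one : ∀ {n} → Polynomial n
  one = con 1ℤ

  fac⁺≈𝟙 : ∀ e → fac⁺ e ≈ 𝟙 + q^ e
  fac⁺≈𝟙 e = trans (fac⁺≈ e) (+-congʳ (sym 1-homo))

  fac⁻≈𝟙 : ∀ e → fac⁻ e ≈ 𝟙 - q^ e
  fac⁻≈𝟙 e = trans (fac⁻≈ e) (+-congʳ (sym 1-homo))

  fac⁺-≥ : ∀ {e} → K ≤ e → fac⁺ e ≈ 1#
  fac⁺-≥ {e} K≤e = begin
    fac⁺ e      ≈⟨ fac⁺≈ e ⟩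
    1# + q^ e   ≈⟨ +-congˡ (q^-≥ K≤e) ⟩
    1# + 0#     ≈⟨ +-identityʳ 1# ⟩
    1#          ∎

  fac⁻-≥ : ∀ {e} → K ≤ e → fac⁻ e ≈ 1#
  fac⁻-≥ {e} K≤e = begin
    fac⁻ e      ≈⟨ fac⁻≈ e ⟩
    1# - q^ e   ≈⟨ +-congˡ (trans (-‿cong (q^-≥ K≤e)) -0#≈0#) ⟩
    1# + 0#     ≈⟨ +-identityʳ 1# ⟩
    1#          ∎

  -- Folds over `upTo`, so that in the truncated ring they coincide by computation with `sumS` and
  -- `prodS` applied to such lists.
  ∑ ∏ : (ℕ → Carrier) → ℕ → Carrier
  ∑ f n = foldr _+_ 0# (map f (upTo n))
  ∏ f n = foldr _*_ 1# (map f (upTo n))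

  ∑-suc : ∀ f n → ∑ f (suc n) ≈ ∑ f n + f n
  ∑-suc f n = trans (reflexive (≡.cong (foldr _+_ 0# ∘ map f) (≡.sym (List.upTo-∷ʳ n)))) (snoc (upTo n))
    where
    snoc : ∀ ks → foldr _+_ 0# (map f (ks ∷ʳ n)) ≈ foldr _+_ 0# (map f ks) + f n
    snoc []       = trans (+-identityʳ (f n)) (sym (+-identityˡ (f n)))
    snoc (k ∷ ks) = trans (+-congˡ (snoc ks)) (sym (+-assoc _ _ _))

  ∏-suc : ∀ f n → ∏ f (suc n) ≈ ∏ f n * f n
  ∏-suc f n = trans (reflexive (≡.cong (foldr _*_ 1# ∘ map f) (≡.sym (List.upTo-∷ʳ n)))) (snoc (upTo n))
    where
    snoc : ∀ ks → foldr _*_ 1# (map f (ks ∷ʳ n)) ≈ foldr _*_ 1# (map f ks) * f n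
    snoc []       = trans (*-identityʳ (f n)) (sym (*-identityˡ (f n)))
    snoc (k ∷ ks) = trans (*-congˡ (snoc ks)) (sym (*-assoc _ _ _))

  ∏-≈1 : ∀ f n → (∀ k → f k ≈ 1#) → ∏ f n ≈ 1#
  ∏-≈1 f zero    _   = refl
  ∏-≈1 f (suc n) f≈1 = begin
    ∏ f (suc n)   ≈⟨ ∏-suc f n ⟩
    ∏ f n * f n   ≈⟨ *-cong (∏-≈1 f n f≈1) (f≈1 n) ⟩
    1# * 1#       ≈⟨ *-identityˡ 1# ⟩
    1#            ∎

  ∏-inverse : ∀ f g n → (∀ k → f k * g k ≈ 1#) → ∏ f n * ∏ g n ≈ 1#
  ∏-inverse f g zero    _    = *-identityˡ 1#
  ∏-inverse f g (suc n) fg≈1 = begin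
    ∏ f (suc n) * ∏ g (suc n)         ≈⟨ *-cong (∏-suc f n) (∏-suc g n) ⟩
    (∏ f n * f n) * (∏ g n * g n)     ≈⟨ solve 4 (λ a b c d → (a :* b) :* (c :* d) := (a :* c) :* (b :* d)) refl _ _ _ _ ⟩
    (∏ f n * ∏ g n) * (f n * g n)     ≈⟨ *-cong (∏-inverse f g n fg≈1) (fg≈1 n) ⟩
    1# * 1#                           ≈⟨ *-identityˡ 1# ⟩
    1#                                ∎

  -- The series α and its three-term relation.

  D : ℕ → Carrier
  D n = ∏ (λ k → fac⁺ (2 ℕ.+ 2 ℕ.* k)) n * ∏ (λ k → inv⁻ (1 ℕ.+ 2 ℕ.* k)) n

  -- `D n` is (-q²;q²)_n / (q²;q²)_n; its recurrence is stated with the new denominator cleared.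
  D-suc : ∀ n → fac⁻ (2 ℕ.+ 2 ℕ.* n) * D (suc n) ≈ fac⁺ (2 ℕ.+ 2 ℕ.* n) * D n
  D-suc n = begin
    fac⁻ e * D (suc n)
      ≈⟨ *-congˡ (*-cong (∏-suc _ n) (∏-suc _ n)) ⟩
    fac⁻ e * ((_ * fac⁺ e) * (_ * inv⁻ (1 ℕ.+ 2 ℕ.* n)))
      ≈⟨ solve 5 (λ m a f b i → m :* ((a :* f) :* (b :* i)) := (m :* i) :* (f :* (a :* b))) refl _ _ _ _ _ ⟩
    (fac⁻ e * inv⁻ (1 ℕ.+ 2 ℕ.* n)) * (fac⁺ e * D n)
      ≈⟨ *-congʳ (fac⁻-inv⁻ (1 ℕ.+ 2 ℕ.* n)) ⟩
    1# * (fac⁺ e * D n)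
      ≈⟨ *-identityˡ _ ⟩
    fac⁺ e * D n ∎
    where e = 2 ℕ.+ 2 ℕ.* n

  -- All factors of (-q^(2j+3);q²)_∞ beyond the first K are 1, because q^K = 0.
  W : ℕ → Carrier
  W j = ∏ (λ i → fac⁺ (3 ℕ.+ 2 ℕ.* (j ℕ.+ i))) K

  private
    2*-≥ : ∀ {m n} → m ≤ n → m ≤ 2 ℕ.* n
    2*-≥ m≤n = ℕ.≤-trans m≤n (ℕ.m≤m+n _ _)

  -- Passing from j to j + 1 drops the first of the K factors and appends one of exponent 3 + 2(j +
  -- K), which is at least K, so the new factor is 1.
  W-suc : ∀ j → W j ≈ fac⁺ (3 ℕ.+ 2 ℕ.* j) * W (suc j)
  W-suc j = begin
    W j                                         ≈⟨ *-identityʳ _ ⟨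
    W j * 1#                                    ≈⟨ *-congˡ (fac⁺-≥ (ℕ.m≤n⇒m≤o+n 3 (2*-≥ (ℕ.m≤n+m K j)))) ⟨
    W j * fac⁺ (3 ℕ.+ 2 ℕ.* (j ℕ.+ K))          ≈⟨ peel K ⟩
    fac⁺ (3 ℕ.+ 2 ℕ.* j) * W (suc j)            ∎
    where
    f : ℕ → ℕ → Carrier
    f j i = fac⁺ (3 ℕ.+ 2 ℕ.* (j ℕ.+ i))

    peel : ∀ n → ∏ (f j) n * f j n ≈ fac⁺ (3 ℕ.+ 2 ℕ.* j) * ∏ (f (suc j)) n
    peel zero    = trans (*-identityˡ _) (trans (reflexive (≡.cong (λ i → fac⁺ (3 ℕ.+ 2 ℕ.* i)) (ℕ.+-identityʳ j)))
                     (sym (*-identityʳ _)))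
    peel (suc n) = begin
      ∏ (f j) (suc n) * f j (suc n)
        ≈⟨ *-cong (trans (∏-suc (f j) n) (peel n)) (reflexive (≡.cong (λ i → fac⁺ (3 ℕ.+ 2 ℕ.* i)) (ℕ.+-suc j n))) ⟩
      fac⁺ (3 ℕ.+ 2 ℕ.* j) * ∏ (f (suc j)) n * f (suc j) n
        ≈⟨ *-assoc _ _ _ ⟩
      fac⁺ (3 ℕ.+ 2 ℕ.* j) * (∏ (f (suc j)) n * f (suc j) n)
        ≈⟨ *-congˡ (∏-suc (f (suc j)) n) ⟨
      fac⁺ (3 ℕ.+ 2 ℕ.* j) * ∏ (f (suc j)) (suc n) ∎

  W-≥ : ∀ {j} → K ≤ j → W j ≈ 1#
  W-≥ K≤j = ∏-≈1 _ K λ i → fac⁺-≥ (ℕ.m≤n⇒m≤o+n 3 (2*-≥ (ℕ.m≤n⇒m≤n+o i K≤j)))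

  -- y^n q^(n(n+1)) (-q²;q²)_n (-y q^(2n+3);q²)_∞ / (q²;q²)_n  at  y = q^(2k).
  term : ℕ → ℕ → Carrier
  term k n = q^ (2 ℕ.* k ℕ.* n ℕ.+ n ℕ.* suc n) * (D n * W (k ℕ.+ n))

  α : ℕ → Carrier
  α k = ∑ (term k) K

  -- The telescoping certificate: its differences in n make up the defect of the three-term relation
  -- for single summands. The factor 1 - q^(2n) vanishes at n = 0 and, for n > 0, cancels the last
  -- denominator in `D n`.
  cert : ℕ → ℕ → Carrier
  cert k n = (𝟙 - q^ (2 ℕ.* n)) * (q^ (2 ℕ.* k ℕ.* n ℕ.+ n ℕ.* suc n) * (D n * W (suc k ℕ.+ n)))

  module Contiguous (k : ℕ) where
    -- With this y, the series `α k`, `α (1 + k)`, `α (2 + k)` are α(y/q²), α(y), α(q²y), and `c₁`,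
    -- `c₂` are the coefficients of the relation between them.
    y : Carrier
    y = q^ (2 ℕ.* suc k)

    c₁ c₂ : Carrier
    c₁ = 𝟙 + y + y * q^ 1
    c₂ = y * q^ 2 * (𝟙 - y * q^ 1)

    -- Every term is a multiple of `E`, `D n` and W(k + n + 2), with a polynomial in y, Z = q^(2n)
    -- and q as cofactor. Once the common factors are exposed, a polynomial identity remains.
    contiguous-term : ∀ n → term k n ≈ c₁ * term (1 ℕ.+ k) n + c₂ * term (2 ℕ.+ k) n + (cert k n - cert k (suc n))
    contiguous-term n = begin
      term k n
        ≈⟨ *-congˡ (*-congˡ W₀) ⟩
      E * (d * ((𝟙 + y * Z * q) * ((𝟙 + y * Z * (q * (q * q))) * w)))
        ≈⟨ solve 6 (λ E d y Z q w →
             E :* (d :* ((one :+ y :* Z :* q) :* ((one :+ y :* Z :* (q :* (q :* q))) :* w))) :=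
             (one :+ y :+ y :* q) :* (E :* Z :* (d :* ((one :+ y :* Z :* (q :* (q :* q))) :* w)))
             :+ y :* (q :* q) :* (one :- y :* q) :* (E :* (Z :* Z) :* (d :* w))
             :+ ((one :- Z) :* (E :* (d :* ((one :+ y :* Z :* (q :* (q :* q))) :* w)))
                 :- E :* (y :* Z) :* w :* ((one :+ q :* q :* Z) :* d)))
             refl E d y Z q w ⟩
      c₁ * (E * Z * (d * ((𝟙 + y * Z * (q * (q * q))) * w)))
        + y * (q * q) * (𝟙 - y * q) * (E * (Z * Z) * (d * w))
        + ((𝟙 - Z) * (E * (d * ((𝟙 + y * Z * (q * (q * q))) * w))) - E * (y * Z) * w * ((𝟙 + q * q * Z) * d))
        ≈⟨ +-cong (+-cong (*-congˡ (*-cong E₁ (*-congˡ W₁)))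
                           (*-cong (*-congʳ (*-congˡ q²)) (*-congʳ E₂)))
                  (+-cong (*-congˡ (*-congˡ (*-congˡ W₁))) (-‿cong next)) ⟨
      c₁ * term (1 ℕ.+ k) n + c₂ * term (2 ℕ.+ k) n + (cert k n - cert k (suc n)) ∎
      where
      E d Z q w : Carrier
      E = q^ (2 ℕ.* k ℕ.* n ℕ.+ n ℕ.* suc n)
      d = D n
      Z = q^ (2 ℕ.* n)
      q = q^ 1
      w = W (2 ℕ.+ k ℕ.+ n)

      q² : q^ 2 ≈ q * q
      q² = q^-+ 1 1

      yZq : q^ (3 ℕ.+ 2 ℕ.* (k ℕ.+ n)) ≈ y * Z * q
      yZq = begin
        q^ (3 ℕ.+ 2 ℕ.* (k ℕ.+ n))
          ≡⟨ ≡.cong q^ (solveℕ 2 (λ k n → κ 3 ⊕ κ 2 ⊗ (k ⊕ n) ⊜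
               κ 2 ⊗ (κ 1 ⊕ k) ⊕ κ 2 ⊗ n ⊕ κ 1) ≡.refl k n) ⟩
        q^ (2 ℕ.* suc k ℕ.+ 2 ℕ.* n ℕ.+ 1)  ≈⟨ q^-+ (2 ℕ.* suc k ℕ.+ 2 ℕ.* n) 1 ⟩
        q^ (2 ℕ.* suc k ℕ.+ 2 ℕ.* n) * q    ≈⟨ *-congʳ (q^-+ (2 ℕ.* suc k) (2 ℕ.* n)) ⟩
        y * Z * q                           ∎

      yZq³ : q^ (3 ℕ.+ 2 ℕ.* (suc k ℕ.+ n)) ≈ y * Z * (q * (q * q))
      yZq³ = begin
        q^ (3 ℕ.+ 2 ℕ.* (suc k ℕ.+ n))
          ≡⟨ ≡.cong q^ (solveℕ 2 (λ k n → κ 3 ⊕ κ 2 ⊗ (κ 1 ⊕ k ⊕ n) ⊜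
               κ 2 ⊗ (κ 1 ⊕ k) ⊕ κ 2 ⊗ n ⊕ κ 3) ≡.refl k n) ⟩
        q^ (2 ℕ.* suc k ℕ.+ 2 ℕ.* n ℕ.+ 3)  ≈⟨ q^-+ (2 ℕ.* suc k ℕ.+ 2 ℕ.* n) 3 ⟩
        q^ (2 ℕ.* suc k ℕ.+ 2 ℕ.* n) * q^ 3 ≈⟨ *-cong (q^-+ (2 ℕ.* suc k) (2 ℕ.* n)) (trans (q^-+ 1 2) (*-congˡ q²)) ⟩
        y * Z * (q * (q * q))               ∎

      W₁ : W (suc k ℕ.+ n) ≈ (𝟙 + y * Z * (q * (q * q))) * w
      W₁ = trans (W-suc (suc k ℕ.+ n)) (*-congʳ (trans (fac⁺≈𝟙 _) (+-congˡ yZq³)))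

      W₀ : W (k ℕ.+ n) ≈ (𝟙 + y * Z * q) * ((𝟙 + y * Z * (q * (q * q))) * w)
      W₀ = trans (W-suc (k ℕ.+ n)) (*-cong (trans (fac⁺≈𝟙 _) (+-congˡ yZq)) W₁)

      E₁ : q^ (2 ℕ.* suc k ℕ.* n ℕ.+ n ℕ.* suc n) ≈ E * Z
      E₁ = trans (reflexive (≡.cong q^ (solveℕ 2 (λ k n →
               κ 2 ⊗ (κ 1 ⊕ k) ⊗ n ⊕ n ⊗ (κ 1 ⊕ n) ⊜
               (κ 2 ⊗ k ⊗ n ⊕ n ⊗ (κ 1 ⊕ n)) ⊕ κ 2 ⊗ n) ≡.refl k n)))
             (q^-+ (2 ℕ.* k ℕ.* n ℕ.+ n ℕ.* suc n) (2 ℕ.* n))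

      E₂ : q^ (2 ℕ.* (2 ℕ.+ k) ℕ.* n ℕ.+ n ℕ.* suc n) ≈ E * (Z * Z)
      E₂ = trans (reflexive (≡.cong q^ (solveℕ 2 (λ k n →
               κ 2 ⊗ (κ 2 ⊕ k) ⊗ n ⊕ n ⊗ (κ 1 ⊕ n) ⊜
               (κ 2 ⊗ k ⊗ n ⊕ n ⊗ (κ 1 ⊕ n)) ⊕ (κ 2 ⊗ n ⊕ κ 2 ⊗ n)) ≡.refl k n)))
             (trans (q^-+ (2 ℕ.* k ℕ.* n ℕ.+ n ℕ.* suc n) (2 ℕ.* n ℕ.+ 2 ℕ.* n)) (*-congˡ (q^-+ (2 ℕ.* n) (2 ℕ.* n))))

      E′ : q^ (2 ℕ.* k ℕ.* suc n ℕ.+ suc n ℕ.* suc (suc n)) ≈ E * (y * Z)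
      E′ = trans (reflexive (≡.cong q^ (solveℕ 2 (λ k n →
               κ 2 ⊗ k ⊗ (κ 1 ⊕ n) ⊕ (κ 1 ⊕ n) ⊗ (κ 2 ⊕ n) ⊜
               (κ 2 ⊗ k ⊗ n ⊕ n ⊗ (κ 1 ⊕ n)) ⊕ (κ 2 ⊗ (κ 1 ⊕ k) ⊕ κ 2 ⊗ n)) ≡.refl k n)))
             (trans (q^-+ (2 ℕ.* k ℕ.* n ℕ.+ n ℕ.* suc n) (2 ℕ.* suc k ℕ.+ 2 ℕ.* n)) (*-congˡ (q^-+ (2 ℕ.* suc k) (2 ℕ.* n))))

      2+2n : q^ (2 ℕ.+ 2 ℕ.* n) ≈ q * q * Z
      2+2n = trans (q^-+ 2 (2 ℕ.* n)) (*-congʳ q²)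

      next : cert k (suc n) ≈ E * (y * Z) * w * ((𝟙 + q * q * Z) * d)
      next = begin
        cert k (suc n)
          ≈⟨ *-cong (trans (reflexive (≡.cong (λ e → 𝟙 - q^ e) (ℕ.*-suc 2 n))) (sym (fac⁻≈𝟙 (2 ℕ.+ 2 ℕ.* n))))
               (*-cong E′ (*-congˡ (reflexive (≡.cong W (ℕ.+-suc (suc k) n))))) ⟩
        fac⁻ (2 ℕ.+ 2 ℕ.* n) * (E * (y * Z) * (D (suc n) * w))
          ≈⟨ solve 4 (λ f e D w → f :* (e :* (D :* w)) := e :* w :* (f :* D)) refl _ _ _ _ ⟩
        E * (y * Z) * w * (fac⁻ (2 ℕ.+ 2 ℕ.* n) * D (suc n))
          ≈⟨ *-congˡ (trans (D-suc n) (*-congʳ (trans (fac⁺≈𝟙 _) (+-congˡ 2+2n)))) ⟩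
        E * (y * Z) * w * ((𝟙 + q * q * Z) * d) ∎

    contiguous-partial : ∀ n →
      ∑ (term k) n ≈ c₁ * ∑ (term (1 ℕ.+ k)) n + c₂ * ∑ (term (2 ℕ.+ k)) n + (cert k 0 - cert k n)
    contiguous-partial zero = begin
      0#                                                  ≈⟨ zeroʳ (c₁ + c₂) ⟨
      (c₁ + c₂) * 0#                                      ≈⟨ solve 4 (λ a b z c → (a :+ b) :* z := a :* z :+ b :* z :+ (c :- c)) refl
                                                              c₁ c₂ 0# (cert k 0) ⟩
      c₁ * 0# + c₂ * 0# + (cert k 0 - cert k 0)           ∎
    contiguous-partial (suc n) = begin
      ∑ (term k) (suc n)
        ≈⟨ ∑-suc (term k) n ⟩
      ∑ (term k) n + term k n
        ≈⟨ +-cong (contiguous-partial n) (contiguous-term n) ⟩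
      (c₁ * S₁ + c₂ * S₂ + (cert k 0 - cert k n)) + (c₁ * t₁ + c₂ * t₂ + (cert k n - cert k (suc n)))
        ≈⟨ solve 9 (λ c₁ c₂ S₁ S₂ t₁ t₂ u v w →
             (c₁ :* S₁ :+ c₂ :* S₂ :+ (u :- v)) :+ (c₁ :* t₁ :+ c₂ :* t₂ :+ (v :- w)) :=
             c₁ :* (S₁ :+ t₁) :+ c₂ :* (S₂ :+ t₂) :+ (u :- w))
             refl c₁ c₂ S₁ S₂ t₁ t₂ (cert k 0) (cert k n) (cert k (suc n)) ⟩
      c₁ * (S₁ + t₁) + c₂ * (S₂ + t₂) + (cert k 0 - cert k (suc n))
        ≈⟨ +-congʳ (+-cong (*-congˡ (∑-suc (term (1 ℕ.+ k)) n)) (*-congˡ (∑-suc (term (2 ℕ.+ k)) n))) ⟨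
      c₁ * ∑ (term (1 ℕ.+ k)) (suc n) + c₂ * ∑ (term (2 ℕ.+ k)) (suc n) + (cert k 0 - cert k (suc n)) ∎
      where
      S₁ S₂ t₁ t₂ : Carrier
      S₁ = ∑ (term (1 ℕ.+ k)) n
      S₂ = ∑ (term (2 ℕ.+ k)) n
      t₁ = term (1 ℕ.+ k) n
      t₂ = term (2 ℕ.+ k) n

    cert-0 : cert k 0 ≈ 0#
    cert-0 = begin
      (𝟙 - q^ 0) * c    ≈⟨ *-congʳ (+-cong 1-homo (-‿cong q^0)) ⟩
      (1# - 1#) * c     ≈⟨ *-congʳ (-‿inverseʳ 1#) ⟩
      0# * c            ≈⟨ zeroˡ c ⟩
      0#                ∎
      where
      c : Carrier
      c = q^ (2 ℕ.* k ℕ.* 0 ℕ.+ 0) * (D 0 * W (suc k ℕ.+ 0))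

    cert-K : cert k K ≈ 0#
    cert-K = trans (*-congˡ (trans (*-congʳ (q^-≥ K≤e)) (zeroˡ _))) (zeroʳ _)
      where
      K≤e : K ≤ 2 ℕ.* k ℕ.* K ℕ.+ K ℕ.* suc K
      K≤e = ℕ.m≤n⇒m≤o+n (2 ℕ.* k ℕ.* K) (ℕ.m≤m*n K (suc K))

    -- Both ends of the telescope vanish: at n = 0 because 1 - q^0 = 0, at n = K because the
    -- exponent contains K(K + 1), which is at least K.
    contiguous : α k ≈ c₁ * α (1 ℕ.+ k) + c₂ * α (2 ℕ.+ k)
    contiguous = begin
      α k
        ≈⟨ contiguous-partial K ⟩
      c₁ * α (1 ℕ.+ k) + c₂ * α (2 ℕ.+ k) + (cert k 0 - cert k K)
        ≈⟨ +-congˡ (trans (+-cong cert-0 (-‿cong cert-K)) (-‿inverseʳ 0#)) ⟩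
      c₁ * α (1 ℕ.+ k) + c₂ * α (2 ℕ.+ k) + 0#
        ≈⟨ +-identityʳ _ ⟩
      c₁ * α (1 ℕ.+ k) + c₂ * α (2 ℕ.+ k) ∎

  -- The companion series γ, and the values of α and γ at k = K.

  γ : ℕ → Carrier
  γ k = α k - q^ (2 ℕ.+ 2 ℕ.* k) * α (suc k)

  q^-2*-suc : ∀ k → q^ (2 ℕ.* suc k) ≈ q^ (2 ℕ.+ 2 ℕ.* k)
  q^-2*-suc k = reflexive (≡.cong q^ (ℕ.*-suc 2 k))

  -- `contiguous` eliminates α_k, and the subtracted y α_(k+1) reduces c₁ to 1 + yq. The coefficient
  -- 2 mirrors the fact that B_i enters both A_(i+1) and C_(i+1).
  γ-suc : ∀ k → γ k ≈ (𝟙 + q^ (3 ℕ.+ 2 ℕ.* k)) * γ (suc k) + (𝟙 + 𝟙) * (q^ (2 ℕ.+ 2 ℕ.* suc k) * α (2 ℕ.+ k))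
  γ-suc k = begin
    α k - q^ (2 ℕ.+ 2 ℕ.* k) * α (suc k)
      ≈⟨ +-cong contiguous (-‿cong (*-congʳ (sym (q^-2*-suc k)))) ⟩
    (c₁ * α₁ + y * q^ 2 * (𝟙 - y * q^ 1) * α₂) - y * α₁
      ≈⟨ solve 5 (λ y q p α₁ α₂ →
           ((one :+ y :+ y :* q) :* α₁ :+ y :* p :* (one :- y :* q) :* α₂) :- y :* α₁ :=
           (one :+ y :* q) :* (α₁ :- p :* y :* α₂) :+ (one :+ one) :* (p :* y :* α₂))
           refl y (q^ 1) (q^ 2) α₁ α₂ ⟩
    (𝟙 + y * q^ 1) * (α₁ - q^ 2 * y * α₂) + (𝟙 + 𝟙) * (q^ 2 * y * α₂)
      ≈⟨ +-cong (*-cong (+-congˡ yq) (+-congˡ (-‿cong (*-congʳ (q^-+ 2 (2 ℕ.* suc k))))))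
                (*-congˡ (*-congʳ (q^-+ 2 (2 ℕ.* suc k)))) ⟨
    (𝟙 + q^ (3 ℕ.+ 2 ℕ.* k)) * γ (suc k) + (𝟙 + 𝟙) * (q^ (2 ℕ.+ 2 ℕ.* suc k) * α₂) ∎
    where
    open Contiguous k
    α₁ α₂ : Carrier
    α₁ = α (1 ℕ.+ k)
    α₂ = α (2 ℕ.+ k)
    yq : q^ (3 ℕ.+ 2 ℕ.* k) ≈ y * q^ 1
    yq = trans (q^-+ 1 (2 ℕ.+ 2 ℕ.* k)) (trans (*-comm _ _) (*-congʳ (sym (q^-2*-suc k))))

  -- Here y = q^(2K) is zero, so only the summand n = 0 survives; 0 < K ensures that the truncated
  -- sum contains it.
  α-K : 0 < K → α K ≈ 1#
  α-K (s≤s {n = K-1} _) = partial K-1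
    where
    partial : ∀ n → ∑ (term K) (suc n) ≈ 1#
    partial zero = begin
      ∑ (term K) 1           ≈⟨ +-identityʳ _ ⟩
      term K 0               ≈⟨ *-cong (reflexive (≡.cong q^ (≡.cong (ℕ._+ 0) (ℕ.*-zeroʳ (2 ℕ.* K)))))
                                  (*-cong (*-identityˡ 1#) (W-≥ (ℕ.m≤m+n K 0))) ⟩
      q^ 0 * (1# * 1#)       ≈⟨ *-cong q^0 (*-identityˡ 1#) ⟩
      1# * 1#                ≈⟨ *-identityˡ 1# ⟩
      1#                     ∎
    partial (suc n) = begin
      ∑ (term K) (2 ℕ.+ n)                     ≈⟨ ∑-suc (term K) (suc n) ⟩
      ∑ (term K) (suc n) + term K (suc n)      ≈⟨ +-cong (partial n) (trans (*-congʳ (q^-≥ K≤e)) (zeroˡ _)) ⟩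
      1# + 0#                                  ≈⟨ +-identityʳ 1# ⟩
      1#                                       ∎
      where
      K≤e : K ≤ 2 ℕ.* K ℕ.* suc n ℕ.+ suc n ℕ.* suc (suc n)
      K≤e = ℕ.m≤n⇒m≤n+o _ (ℕ.≤-trans (2*-≥ ℕ.≤-refl) (ℕ.m≤m*n (2 ℕ.* K) (suc n)))

  γ-K : 0 < K → γ K ≈ 1#
  γ-K 0<K = begin
    α K - q^ (2 ℕ.+ 2 ℕ.* K) * α (suc K)   ≈⟨ +-congˡ (-‿cong (trans (*-congʳ (q^-≥ (ℕ.m≤n⇒m≤o+n 2 (2*-≥ ℕ.≤-refl)))) (zeroˡ _))) ⟩
    α K - 0#                               ≈⟨ +-cong (α-K 0<K) -0#≈0# ⟩
    1# + 0#                                ≈⟨ +-identityʳ 1# ⟩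
    1#                                     ∎

  -- The sum in the theorem as a value of α, and (q;q)_n modulo q^K.

  sumSide : Carrier
  sumSide = ∑ (λ n → q^ (n ℕ.* suc n)
                * (∏ (λ k → fac⁺ (2 ℕ.+ 2 ℕ.* k)) n
                   * (∏ (λ k → inv⁺ (2 ℕ.+ 2 ℕ.* k)) n * ∏ (λ k → inv⁻ (1 ℕ.+ 2 ℕ.* k)) n))) K

  -- Dividing (-q³;q²)_∞ by the (-q³;q²)_n of the n-th summand leaves (-q^(2n+3);q²)_∞, which is the
  -- tail product in `term 0 n`.
  sumSide-W : sumSide * W 0 ≈ α 0
  sumSide-W = partial K
    where
    P J I : ℕ → Carrier
    P = ∏ (λ k → fac⁺ (2 ℕ.+ 2 ℕ.* k))
    J = ∏ (λ k → inv⁺ (2 ℕ.+ 2 ℕ.* k))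
    I = ∏ (λ k → inv⁻ (1 ℕ.+ 2 ℕ.* k))

    J-W : ∀ n → J n * W 0 ≈ W n
    J-W zero    = *-identityˡ _
    J-W (suc n) = begin
      J (suc n) * W 0                              ≈⟨ *-congʳ (∏-suc _ n) ⟩
      J n * i * W 0                                ≈⟨ solve 3 (λ j i w → j :* i :* w := (j :* w) :* i) refl _ _ _ ⟩
      J n * W 0 * i                                ≈⟨ *-congʳ (trans (J-W n) (W-suc n)) ⟩
      fac⁺ (3 ℕ.+ 2 ℕ.* n) * W (suc n) * i         ≈⟨ solve 3 (λ f w i → f :* w :* i := (f :* i) :* w) refl _ _ _ ⟩
      fac⁺ (3 ℕ.+ 2 ℕ.* n) * i * W (suc n)         ≈⟨ *-congʳ (fac⁺-inv⁺ (2 ℕ.+ 2 ℕ.* n)) ⟩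
      1# * W (suc n)                               ≈⟨ *-identityˡ _ ⟩
      W (suc n)                                    ∎
      where i = inv⁺ (2 ℕ.+ 2 ℕ.* n)

    s : ℕ → Carrier
    s n = q^ (n ℕ.* suc n) * (P n * (J n * I n))

    s-W : ∀ n → s n * W 0 ≈ term 0 n
    s-W n = begin
      q^ (n ℕ.* suc n) * (P n * (J n * I n)) * W 0
        ≈⟨ solve 5 (λ e p j i w → e :* (p :* (j :* i)) :* w := e :* (p :* i :* (j :* w))) refl _ _ _ _ _ ⟩
      q^ (n ℕ.* suc n) * (D n * (J n * W 0))
        ≈⟨ *-congˡ (*-congˡ (J-W n)) ⟩
      term 0 n ∎

    partial : ∀ m → ∑ s m * W 0 ≈ ∑ (term 0) m
    partial zero    = zeroˡ _
    partial (suc m) = begin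
      ∑ s (suc m) * W 0             ≈⟨ *-congʳ (∑-suc s m) ⟩
      (∑ s m + s m) * W 0           ≈⟨ distribʳ _ _ _ ⟩
      ∑ s m * W 0 + s m * W 0       ≈⟨ +-cong (partial m) (s-W m) ⟩
      ∑ (term 0) m + term 0 m       ≈⟨ ∑-suc (term 0) m ⟨
      ∑ (term 0) (suc m)            ∎

  poch⁻ : ℕ → Carrier
  poch⁻ = ∏ (λ k → fac⁻ (suc k))

  -- The factors beyond the first K have exponents above K and are 1, so (q;q)_n is stationary from
  -- n = K on.
  poch⁻-+ : ∀ m → poch⁻ (K ℕ.+ m) ≈ poch⁻ K
  poch⁻-+ zero    = reflexive (≡.cong poch⁻ (ℕ.+-identityʳ K))
  poch⁻-+ (suc m) = begin
    poch⁻ (K ℕ.+ suc m)                       ≡⟨ ≡.cong poch⁻ (ℕ.+-suc K m) ⟩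
    poch⁻ (suc (K ℕ.+ m))                     ≈⟨ ∏-suc _ (K ℕ.+ m) ⟩
    poch⁻ (K ℕ.+ m) * fac⁻ (suc (K ℕ.+ m))    ≈⟨ *-cong (poch⁻-+ m) (fac⁻-≥ (ℕ.m≤n⇒m≤1+n (ℕ.m≤m+n K m))) ⟩
    poch⁻ K * 1#                              ≈⟨ *-identityʳ _ ⟩
    poch⁻ K                                   ∎

  -- From the recursion for the counting series to their limit.

  module Counting
    -- X a b stands for X(a,b). `X-low` and `X-high` express that in profile (4,0) the first row has
    -- at least as many parts as the second and at most four more; `X-rec` is inclusion-exclusion
    -- with the subtracted terms moved across.
    (X : ℕ → ℕ → Carrier)
    (X-0 : ∀ a → X a 0 ≈ 0#)
    (X-1 : X 1 1 ≈ 1#)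
    (X-low : ∀ b → X b (suc b) ≈ X b b)
    (X-high : ∀ b → X (5 ℕ.+ b) b ≈ X (4 ℕ.+ b) b)
    (X-rec : ∀ d b → d ≤ 4 → 0 < d ℕ.+ 2 ℕ.* b →
      X (suc (d ℕ.+ b)) (suc b) + X (d ℕ.+ b) b
        ≈ X (d ℕ.+ b) (suc b) + X (suc (d ℕ.+ b)) b + q^ (d ℕ.+ 2 ℕ.* b) * X (suc (d ℕ.+ b)) (suc b))
    where

    X-step : ∀ d b → d ≤ 4 → 0 < d ℕ.+ 2 ℕ.* b →
      X (suc (d ℕ.+ b)) (suc b) * fac⁻ (d ℕ.+ 2 ℕ.* b) ≈ X (d ℕ.+ b) (suc b) + X (suc (d ℕ.+ b)) b - X (d ℕ.+ b) b
    X-step d b d≤4 0<w = begin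
      x₁₁ * fac⁻ w                              ≈⟨ *-congˡ (fac⁻≈𝟙 w) ⟩
      x₁₁ * (𝟙 - q^ w)                          ≈⟨ solve 3 (λ x y e → x :* (one :- e) := (x :+ y) :- (y :+ e :* x)) refl x₁₁ x₀₀ (q^ w) ⟩
      (x₁₁ + x₀₀) - (x₀₀ + q^ w * x₁₁)          ≈⟨ +-congʳ (X-rec d b d≤4 0<w) ⟩
      (x₀₁ + x₁₀ + q^ w * x₁₁) - (x₀₀ + q^ w * x₁₁)
                                                ≈⟨ solve 4 (λ x y z e → (x :+ y :+ e) :- (z :+ e) := x :+ y :- z) refl x₀₁ x₁₀ x₀₀ (q^ w * x₁₁) ⟩
      x₀₁ + x₁₀ - x₀₀                           ∎
      where
      w : ℕ
      w = d ℕ.+ 2 ℕ.* b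
      x₀₀ x₀₁ x₁₀ x₁₁ : Carrier
      x₀₀ = X (d ℕ.+ b) b
      x₀₁ = X (d ℕ.+ b) (suc b)
      x₁₀ = X (suc (d ℕ.+ b)) b
      x₁₁ = X (suc (d ℕ.+ b)) (suc b)

    -- The last factor of (q;q)_(m+1) is precisely the 1 - q^(a+b) of the recursion, so multiplying
    -- by it clears the denominator.
    X-poch : ∀ d b {m} → d ≤ 4 → d ℕ.+ 2 ℕ.* b ≡ suc m →
      X (suc (d ℕ.+ b)) (suc b) * poch⁻ (suc m) ≈ (X (d ℕ.+ b) (suc b) + X (suc (d ℕ.+ b)) b - X (d ℕ.+ b) b) * poch⁻ m
    X-poch d b {m} d≤4 eq = begin
      x * poch⁻ (suc m)                  ≈⟨ *-congˡ (∏-suc _ m) ⟩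
      x * (poch⁻ m * fac⁻ (suc m))       ≈⟨ solve 3 (λ x p f → x :* (p :* f) := x :* f :* p) refl _ _ _ ⟩
      x * fac⁻ (suc m) * poch⁻ m         ≡⟨ ≡.cong (λ e → x * fac⁻ e * poch⁻ m) eq ⟨
      x * fac⁻ (d ℕ.+ 2 ℕ.* b) * poch⁻ m ≈⟨ *-congʳ (X-step d b d≤4 (≡.subst (0 <_) (≡.sym eq) ℕ.z<s)) ⟩
      (X (d ℕ.+ b) (suc b) + X (suc (d ℕ.+ b)) b - X (d ℕ.+ b) b) * poch⁻ m ∎
      where x = X (suc (d ℕ.+ b)) (suc b)

    -- `A`, `B`, `C` lie on the antidiagonal a + b = 2i + 4 with a - b = 0, 2, 4; `U` and `V` lie on
    -- the next one with a - b = 1, 3. Each is multiplied by (q;q)_(a+b-2).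
    A B C U V : ℕ → Carrier
    A i = X (2 ℕ.+ i) (2 ℕ.+ i) * poch⁻ (2 ℕ.+ 2 ℕ.* i)
    B i = X (3 ℕ.+ i) (1 ℕ.+ i) * poch⁻ (2 ℕ.+ 2 ℕ.* i)
    C i = X (4 ℕ.+ i) i         * poch⁻ (2 ℕ.+ 2 ℕ.* i)
    U i = X (3 ℕ.+ i) (2 ℕ.+ i) * poch⁻ (3 ℕ.+ 2 ℕ.* i)
    V i = X (4 ℕ.+ i) (1 ℕ.+ i) * poch⁻ (3 ℕ.+ 2 ℕ.* i)

    poch⁻-2*-suc : ∀ i → poch⁻ (2 ℕ.+ 2 ℕ.* suc i) ≈ poch⁻ (4 ℕ.+ 2 ℕ.* i)
    poch⁻-2*-suc i = reflexive (≡.cong (poch⁻ ∘ (2 ℕ.+_)) (ℕ.*-suc 2 i))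

    private
      drop-last : ∀ {x y z} p → z ≈ y → (x + y - z) * p ≈ x * p
      drop-last {x} {y} p z≈y = *-congʳ (trans (+-congˡ (-‿cong z≈y))
        (trans (+-assoc x y (- y)) (trans (+-congˡ (-‿inverseʳ y)) (+-identityʳ x))))

      drop-first : ∀ {x y z} p → z ≈ x → (x + y - z) * p ≈ y * p
      drop-first p z≈x = trans (*-congʳ (+-congʳ (+-comm _ _))) (drop-last p z≈x)

    -- On the edge a = b, `X-low` cancels two of the three terms of the recursion and leaves the
    -- neighbour with a - b = 1. Thus A_(i+1) is U_i.
    A-odd : ∀ i → A i ≈ X (2 ℕ.+ i) (1 ℕ.+ i) * poch⁻ (1 ℕ.+ 2 ℕ.* i)
    A-odd i = trans (X-poch 0 (suc i) z≤n (ℕ.*-suc 2 i)) (drop-first _ (sym (X-low (suc i))))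

    -- On the opposite edge a - b = 4 the cancellation comes from `X-high`. For i = 0 both sides
    -- vanish, since no row has fewer than 0 parts.
    C-odd : ∀ i → C i ≈ X (3 ℕ.+ i) i * poch⁻ (1 ℕ.+ 2 ℕ.* i)
    C-odd zero    = trans (trans (*-congʳ (X-0 4)) (zeroˡ _)) (sym (trans (*-congʳ (X-0 3)) (zeroˡ _)))
    C-odd (suc i) = begin
      C (suc i)
        ≈⟨ *-congˡ (poch⁻-2*-suc i) ⟩
      X (5 ℕ.+ i) (1 ℕ.+ i) * poch⁻ (4 ℕ.+ 2 ℕ.* i)
        ≈⟨ X-poch 4 i ℕ.≤-refl ≡.refl ⟩
      (X (4 ℕ.+ i) (1 ℕ.+ i) + X (5 ℕ.+ i) i - X (4 ℕ.+ i) i) * poch⁻ (3 ℕ.+ 2 ℕ.* i)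
        ≈⟨ drop-last _ (sym (X-high i)) ⟩
      X (4 ℕ.+ i) (1 ℕ.+ i) * poch⁻ (3 ℕ.+ 2 ℕ.* i)
        ≡⟨ ≡.cong (λ e → X (4 ℕ.+ i) (1 ℕ.+ i) * poch⁻ (1 ℕ.+ e)) (ℕ.*-suc 2 i) ⟨
      X (4 ℕ.+ i) (1 ℕ.+ i) * poch⁻ (1 ℕ.+ 2 ℕ.* suc i) ∎

    -- Only the subtracted term is expanded: in each use z * poch⁻ m is again one of A, B, C.
    absorb : ∀ x y z m → (x + y - z) * poch⁻ (suc m) ≈ x * poch⁻ (suc m) + y * poch⁻ (suc m) - z * poch⁻ m * (𝟙 - q^ (suc m))
    absorb x y z m = trans
      (solve 4 (λ x y z p → (x :+ y :- z) :* p := x :* p :+ y :* p :- z :* p) refl x y z (poch⁻ (suc m)))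
      (+-congˡ (-‿cong (trans (*-congˡ (trans (∏-suc _ m) (*-congˡ (fac⁻≈𝟙 (suc m))))) (sym (*-assoc _ _ _)))))

    U-rec : ∀ i → U i ≈ q^ (2 ℕ.+ 2 ℕ.* i) * A i + B i
    U-rec i = begin
      U i
        ≈⟨ X-poch 1 (suc i) (s≤s z≤n) (≡.cong suc (ℕ.*-suc 2 i)) ⟩
      (X (2 ℕ.+ i) (2 ℕ.+ i) + X (3 ℕ.+ i) (1 ℕ.+ i) - X (2 ℕ.+ i) (1 ℕ.+ i)) * poch⁻ (2 ℕ.+ 2 ℕ.* i)
        ≈⟨ absorb _ _ _ (1 ℕ.+ 2 ℕ.* i) ⟩
      A i + B i - X (2 ℕ.+ i) (1 ℕ.+ i) * poch⁻ (1 ℕ.+ 2 ℕ.* i) * (𝟙 - q^ (2 ℕ.+ 2 ℕ.* i))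
        ≈⟨ +-congˡ (-‿cong (*-congʳ (A-odd i))) ⟨
      A i + B i - A i * (𝟙 - q^ (2 ℕ.+ 2 ℕ.* i))
        ≈⟨ solve 3 (λ a b y → a :+ b :- a :* (one :- y) := y :* a :+ b) refl (A i) (B i) _ ⟩
      q^ (2 ℕ.+ 2 ℕ.* i) * A i + B i ∎

    V-rec : ∀ i → V i ≈ B i + q^ (2 ℕ.+ 2 ℕ.* i) * C i
    V-rec i = begin
      V i
        ≈⟨ X-poch 3 i (s≤s (s≤s (s≤s z≤n))) ≡.refl ⟩
      (X (3 ℕ.+ i) (1 ℕ.+ i) + X (4 ℕ.+ i) i - X (3 ℕ.+ i) i) * poch⁻ (2 ℕ.+ 2 ℕ.* i)
        ≈⟨ absorb _ _ _ (1 ℕ.+ 2 ℕ.* i) ⟩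
      B i + C i - X (3 ℕ.+ i) i * poch⁻ (1 ℕ.+ 2 ℕ.* i) * (𝟙 - q^ (2 ℕ.+ 2 ℕ.* i))
        ≈⟨ +-congˡ (-‿cong (*-congʳ (C-odd i))) ⟨
      B i + C i - C i * (𝟙 - q^ (2 ℕ.+ 2 ℕ.* i))
        ≈⟨ solve 3 (λ b c y → b :+ c :- c :* (one :- y) := b :+ y :* c) refl (B i) (C i) _ ⟩
      B i + q^ (2 ℕ.+ 2 ℕ.* i) * C i ∎

    A-suc : ∀ i → A (suc i) ≈ q^ (2 ℕ.+ 2 ℕ.* i) * A i + B i
    A-suc i = trans (A-odd (suc i))
      (trans (reflexive (≡.cong (λ e → X (3 ℕ.+ i) (2 ℕ.+ i) * poch⁻ (1 ℕ.+ e)) (ℕ.*-suc 2 i))) (U-rec i))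

    C-suc : ∀ i → C (suc i) ≈ B i + q^ (2 ℕ.+ 2 ℕ.* i) * C i
    C-suc i = trans (C-odd (suc i))
      (trans (reflexive (≡.cong (λ e → X (4 ℕ.+ i) (1 ℕ.+ i) * poch⁻ (1 ℕ.+ e)) (ℕ.*-suc 2 i))) (V-rec i))

    B-suc : ∀ i → B (suc i) ≈ (𝟙 + q^ (3 ℕ.+ 2 ℕ.* i)) * B i + q^ (2 ℕ.+ 2 ℕ.* i) * (A i + C i)
    B-suc i = begin
      B (suc i)
        ≈⟨ *-congˡ (poch⁻-2*-suc i) ⟩
      X (4 ℕ.+ i) (2 ℕ.+ i) * poch⁻ (4 ℕ.+ 2 ℕ.* i)
        ≈⟨ X-poch 2 (suc i) (s≤s (s≤s z≤n)) (≡.cong (2 ℕ.+_) (ℕ.*-suc 2 i)) ⟩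
      (X (3 ℕ.+ i) (2 ℕ.+ i) + X (4 ℕ.+ i) (1 ℕ.+ i) - X (3 ℕ.+ i) (1 ℕ.+ i)) * poch⁻ (3 ℕ.+ 2 ℕ.* i)
        ≈⟨ absorb _ _ _ (2 ℕ.+ 2 ℕ.* i) ⟩
      U i + V i - B i * (𝟙 - q^ (3 ℕ.+ 2 ℕ.* i))
        ≈⟨ +-congʳ (+-cong (U-rec i) (V-rec i)) ⟩
      (y * A i + B i) + (B i + y * C i) - B i * (𝟙 - z)
        ≈⟨ solve 5 (λ y z a b c → (y :* a :+ b) :+ (b :+ y :* c) :- b :* (one :- z) :=
             (one :+ z) :* b :+ y :* (a :+ c)) refl y z (A i) (B i) (C i) ⟩
      (𝟙 + z) * B i + y * (A i + C i) ∎
      where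
      y z : Carrier
      y = q^ (2 ℕ.+ 2 ℕ.* i)
      z = q^ (3 ℕ.+ 2 ℕ.* i)

    X21 : X 2 1 * poch⁻ 1 ≈ 1#
    X21 = begin
      X 2 1 * poch⁻ 1                      ≈⟨ X-poch 1 0 (s≤s z≤n) ≡.refl ⟩
      (X 1 1 + X 2 0 - X 1 0) * poch⁻ 0    ≈⟨ drop-last _ (trans (X-0 1) (sym (X-0 2))) ⟩
      X 1 1 * 1#                           ≈⟨ *-identityʳ _ ⟩
      X 1 1                                ≈⟨ X-1 ⟩
      1#                                   ∎

    A-0 : A 0 ≈ 1#
    A-0 = trans (A-odd 0) X21

    B-0 : B 0 ≈ 1#
    B-0 = begin
      B 0                                  ≈⟨ X-poch 2 0 (s≤s (s≤s z≤n)) ≡.refl ⟩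
      (X 2 1 + X 3 0 - X 2 0) * poch⁻ 1    ≈⟨ drop-last _ (trans (X-0 2) (sym (X-0 3))) ⟩
      X 2 1 * poch⁻ 1                      ≈⟨ X21 ⟩
      1#                                   ∎

    C-0 : C 0 ≈ 0#
    C-0 = trans (*-congʳ (X-0 4)) (zeroˡ _)

    -- The vectors (q^(2i+2) α_(i+1), γ_i, q^(2i+2) α_(i+1)) obey the transpose of the recursion for (A, B, C).
    invariant : ∀ i → q^ (2 ℕ.+ 2 ℕ.* i) * α (suc i) * (A i + C i) + γ i * B i ≈ α 0
    invariant zero = begin
      q^ 2 * α 1 * (A 0 + C 0) + γ 0 * B 0   ≈⟨ +-cong (*-congˡ (trans (+-cong A-0 C-0) (+-identityʳ _))) (*-congˡ B-0) ⟩
      q^ 2 * α 1 * 1# + γ 0 * 1#             ≈⟨ +-cong (*-identityʳ _) (*-identityʳ _) ⟩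
      q^ 2 * α 1 + (α 0 - q^ 2 * α 1)        ≈⟨ solve 2 (λ x a → x :+ (a :- x) := a) refl _ _ ⟩
      α 0                                    ∎
    invariant (suc i) = begin
      y′ * α₂ * (A (suc i) + C (suc i)) + γ (suc i) * B (suc i)
        ≈⟨ +-cong (*-congˡ (+-cong (A-suc i) (C-suc i))) (*-congˡ (B-suc i)) ⟩
      y′ * α₂ * ((y * A i + B i) + (B i + y * C i)) + γ (suc i) * ((𝟙 + z) * B i + y * (A i + C i))
        ≈⟨ solve 8 (λ y′ α₂ y a b c z g →
             y′ :* α₂ :* ((y :* a :+ b) :+ (b :+ y :* c)) :+ g :* ((one :+ z) :* b :+ y :* (a :+ c)) :=
             y :* (g :+ y′ :* α₂) :* (a :+ c) :+ ((one :+ z) :* g :+ (one :+ one) :* (y′ :* α₂)) :* b)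
             refl y′ α₂ y (A i) (B i) (C i) z (γ (suc i)) ⟩
      y * (γ (suc i) + y′ * α₂) * (A i + C i) + ((𝟙 + z) * γ (suc i) + (𝟙 + 𝟙) * (y′ * α₂)) * B i
        ≈⟨ +-cong (*-congʳ (*-congˡ (solve 2 (λ x a → (a :- x) :+ x := a) refl _ _))) (*-congʳ (sym (γ-suc i))) ⟩
      y * α (suc i) * (A i + C i) + γ i * B i
        ≈⟨ invariant i ⟩
      α 0 ∎
      where
      y y′ z α₂ : Carrier
      y  = q^ (2 ℕ.+ 2 ℕ.* i)
      y′ = q^ (2 ℕ.+ 2 ℕ.* suc i)
      z  = q^ (3 ℕ.+ 2 ℕ.* i)
      α₂ = α (2 ℕ.+ i)

    -- At i = K the power q^(2K+2) is zero and γ_K = 1, so the invariant reduces to B_K, which then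
    -- equals A_(K+1).
    A-limit : 0 < K → A (suc K) ≈ α 0
    A-limit 0<K = begin
      A (suc K)                                   ≈⟨ A-suc K ⟩
      y * A K + B K                               ≈⟨ +-cong (trans (*-congʳ y≈0) (zeroˡ _)) (sym (trans (*-congʳ (γ-K 0<K)) (*-identityˡ _))) ⟩
      0# + γ K * B K                              ≈⟨ +-congʳ (trans (*-congʳ (trans (*-congʳ y≈0) (zeroˡ _))) (zeroˡ _)) ⟨
      y * α (suc K) * (A K + C K) + γ K * B K     ≈⟨ invariant K ⟩
      α 0                                         ∎
      where
      y : Carrier
      y = q^ (2 ℕ.+ 2 ℕ.* K)
      y≈0 : y ≈ 0#
      y≈0 = q^-≥ (ℕ.m≤n⇒m≤o+n 2 (2*-≥ ℕ.≤-refl))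

    X-limit : 0 < K → X (3 ℕ.+ K) (3 ℕ.+ K) ≈ sumSide * (∏ (λ k → fac⁺ (3 ℕ.+ 2 ℕ.* k)) K * ∏ inv⁻ K)
    X-limit 0<K = begin
      x                                                   ≈⟨ *-identityʳ x ⟨
      x * 1#                                              ≈⟨ *-congˡ (∏-inverse _ inv⁻ K fac⁻-inv⁻) ⟨
      x * (poch⁻ K * ∏ inv⁻ K)                            ≈⟨ *-assoc _ _ _ ⟨
      -- Adding 4 + K further trivial factors reaches (q;q)_(2K+4), the multiplier contained in
      -- `A (suc K)`.
      x * poch⁻ K * ∏ inv⁻ K                              ≈⟨ *-congʳ (*-congˡ (poch⁻-+ (4 ℕ.+ K))) ⟨
      x * poch⁻ (K ℕ.+ (4 ℕ.+ K)) * ∏ inv⁻ K              ≡⟨ ≡.cong (λ e → x * poch⁻ e * ∏ inv⁻ K)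
                                                              (solveℕ 1 (λ k → k ⊕ (κ 4 ⊕ k) ⊜ κ 2 ⊕ κ 2 ⊗ (κ 1 ⊕ k)) ≡.refl K) ⟩
      A (suc K) * ∏ inv⁻ K                                ≈⟨ *-congʳ (A-limit 0<K) ⟩
      α 0 * ∏ inv⁻ K                                      ≈⟨ *-congʳ sumSide-W ⟨
      sumSide * W 0 * ∏ inv⁻ K                            ≈⟨ *-assoc _ _ _ ⟩
      sumSide * (W 0 * ∏ inv⁻ K)                          ∎
      where x = X (3 ℕ.+ K) (3 ℕ.+ K)

-- Cylindric partitions counted by the lengths of their two rows

module Cylindric where
  open import Data.Nat.Base using (_+_)
  open ≡

  -- Adding 1 to, and subtracting 1 from, the parts of a row.

  up : ℕ → List ℕ → List ℕ
  up zero    _        = []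
  up (suc a) []       = 1 ∷ up a []
  up (suc a) (z ∷ zs) = suc z ∷ up a zs

  -- Stopping at the first part that is at most 1 is correct for decreasing rows, where every later
  -- part also drops to 0. The inverse `up a` pads with zeros, so as to produce exactly a parts.
  down : List ℕ → List ℕ
  down []                 = []
  down (zero ∷ _)         = []
  down (suc zero ∷ _)     = []
  down (suc (suc x) ∷ xs) = suc x ∷ down xs

  Positive Decreasing : List ℕ → Set
  Positive      = All (0 <_)
  Decreasing xs = ∀ j → part xs (suc j) ≤ part xs j

  part-≥-length : ∀ xs {j} → length xs ≤ j → part xs j ≡ 0
  part-≥-length []                   _           = refl
  part-≥-length (x ∷ xs) {suc j} (s≤s len≤j) = part-≥-length xs len≤j

  part-<-length : ∀ {xs} → Positive xs → ∀ {j} → j < length xs → 0 < part xs j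
  part-<-length (0<x ∷ _)  {zero}  _         = 0<x
  part-<-length (_ ∷ 0<xs) {suc j} (s≤s j<n) = part-<-length 0<xs j<n

  length-≤ : ∀ {xs} → Positive xs → ∀ {j} → part xs j ≡ 0 → length xs ≤ j
  length-≤ {xs} 0<xs {j} eq = ℕ.≮⇒≥ λ j<n → ℕ.n≮0 (subst (0 <_) eq (part-<-length 0<xs j<n))

  -- Positivity excludes trailing zeros, the only way in which different lists can have the same
  -- parts.
  part-ext : ∀ {xs ys} → Positive xs → Positive ys → (∀ j → part xs j ≡ part ys j) → xs ≡ ys
  part-ext []            []            _  = refl
  part-ext []            (0<y ∷ _)     eq = contradiction (eq 0) (ℕ.<⇒≢ 0<y)
  part-ext (0<x ∷ _)     []            eq = contradiction (sym (eq 0)) (ℕ.<⇒≢ 0<x)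
  part-ext (_ ∷ 0<xs)    (_ ∷ 0<ys)    eq = cong₂ _∷_ (eq 0) (part-ext 0<xs 0<ys (eq ∘ suc))

  part-≤-head : ∀ xs → Decreasing xs → ∀ j → part xs j ≤ part xs 0
  part-≤-head xs dec zero    = ℕ.≤-refl
  part-≤-head xs dec (suc j) = ℕ.≤-trans (dec j) (part-≤-head xs dec j)

  length-≤-sum : ∀ {xs} → Positive xs → length xs ≤ sum xs
  length-≤-sum []           = z≤n
  length-≤-sum (0<x ∷ 0<xs) = ℕ.+-mono-≤ 0<x (length-≤-sum 0<xs)

  up-positive : ∀ a zs → Positive (up a zs)
  up-positive zero    _        = []
  up-positive (suc a) []       = z<s ∷ up-positive a []
  up-positive (suc a) (z ∷ zs) = z<s ∷ up-positive a zs

  length-up : ∀ a zs → length (up a zs) ≡ a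
  length-up zero    _        = refl
  length-up (suc a) []       = cong suc (length-up a [])
  length-up (suc a) (_ ∷ zs) = cong suc (length-up a zs)

  sum-up : ∀ a {zs} → length zs ≤ a → sum (up a zs) ≡ a + sum zs
  sum-up zero    {[]}     _         = refl
  sum-up (suc a) {[]}     _         = cong suc (sum-up a z≤n)
  sum-up (suc a) {z ∷ zs} (s≤s len≤a) = cong suc (begin
    z + sum (up a zs)     ≡⟨ cong (z ℕ.+_) (sum-up a len≤a) ⟩
    z + (a + sum zs)      ≡⟨ ℕ.+-assoc z a _ ⟨
    z + a + sum zs        ≡⟨ cong (_+ sum zs) (ℕ.+-comm z a) ⟩
    a + z + sum zs        ≡⟨ ℕ.+-assoc a z _ ⟩
    a + (z + sum zs)      ∎)
    where open ≡-Reasoning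

  part-up-< : ∀ {a} zs {j} → j < a → part (up a zs) j ≡ suc (part zs j)
  part-up-< []       {zero}  (s≤s _)   = refl
  part-up-< []       {suc j} (s≤s j<a) = part-up-< [] j<a
  part-up-< (_ ∷ _)  {zero}  (s≤s _)   = refl
  part-up-< (_ ∷ zs) {suc j} (s≤s j<a) = part-up-< zs j<a

  part-up-≥ : ∀ {a} zs {j} → a ≤ j → part (up a zs) j ≡ 0
  part-up-≥ {a} zs {j} a≤j = part-≥-length (up a zs) (subst (_≤ j) (sym (length-up a zs)) a≤j)

  -- If the smaller part is raised, then so is the larger one, because j < b forces i < a; otherwise
  -- the smaller part becomes 0. This serves both the decrease within a row and the cylindric
  -- inequalities between rows.
  part-up-mono : ∀ {a b} zs ws {i j} → (j < b → i < a) → part ws j ≤ part zs i →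
                 part (up b ws) j ≤ part (up a zs) i
  part-up-mono {b = b} zs ws {i} {j} j<b⇒i<a le with j ℕ.<? b
  ... | yes j<b rewrite part-up-< ws j<b | part-up-< zs (j<b⇒i<a j<b) = s≤s le
  ... | no  j≮b rewrite part-up-≥ ws (ℕ.≮⇒≥ j≮b) = z≤n

  part-down : ∀ xs → Decreasing xs → ∀ j → part (down xs) j ≡ pred (part xs j)
  part-down []                   _   _       = refl
  part-down xs@(zero ∷ _)        dec j       = sym (cong pred (ℕ.n≤0⇒n≡0 (part-≤-head xs dec j)))
  part-down xs@(suc zero ∷ _)    dec j       = sym (ℕ.n≤0⇒n≡0 (ℕ.pred-mono-≤ (part-≤-head xs dec j)))
  part-down (suc (suc x) ∷ _)    dec zero    = refl
  part-down (suc (suc x) ∷ xs)   dec (suc j) = part-down xs (dec ∘ suc) j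

  down-positive : ∀ xs → Positive (down xs)
  down-positive []                 = []
  down-positive (zero ∷ _)         = []
  down-positive (suc zero ∷ _)     = []
  down-positive (suc (suc _) ∷ xs) = z<s ∷ down-positive xs

  length-down : ∀ xs → length (down xs) ≤ length xs
  length-down []                 = z≤n
  length-down (zero ∷ _)         = z≤n
  length-down (suc zero ∷ _)     = z≤n
  length-down (suc (suc _) ∷ xs) = s≤s (length-down xs)

  down-up : ∀ a {zs} → Positive zs → length zs ≤ a → down (up a zs) ≡ zs
  down-up zero    {[]}         _          _           = refl
  down-up (suc a) {[]}         _          _           = refl
  down-up (suc a) {suc z ∷ zs} (_ ∷ 0<zs) (s≤s len≤a) = cong (suc z ∷_) (down-up a 0<zs len≤a)

  up-down : ∀ {xs} → IsPartition xs → up (length xs) (down xs) ≡ xs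
  up-down {xs} (0<xs , dec) = part-ext (up-positive _ (down xs)) 0<xs parts
    where
    parts : ∀ j → part (up (length xs) (down xs)) j ≡ part xs j
    parts j with j ℕ.<? length xs
    ... | yes j<n = begin
      part (up (length xs) (down xs)) j   ≡⟨ part-up-< (down xs) j<n ⟩
      suc (part (down xs) j)              ≡⟨ cong suc (part-down xs dec j) ⟩
      suc (pred (part xs j))              ≡⟨ ℕ.suc-pred (part xs j) {{>-nonZero (part-<-length 0<xs j<n)}} ⟩
      part xs j                           ∎
      where open ≡-Reasoning
    ... | no j≮n = trans (part-up-≥ (down xs) (ℕ.≮⇒≥ j≮n)) (sym (part-≥-length xs (ℕ.≮⇒≥ j≮n)))

  sum-down : ∀ {xs} → IsPartition xs → sum xs ≡ length xs + sum (down xs)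
  sum-down {xs} p = trans (cong sum (sym (up-down p))) (sum-up (length xs) (length-down xs))

  -- Cylindric pairs of rows and their lengths.

  record IsCylindric (c₁ c₂ : ℕ) (xs ys : List ℕ) : Set where
    constructor isCyl
    field
      isPart¹ : IsPartition xs
      isPart² : IsPartition ys
      cond₁   : ∀ j → part ys (j + c₂) ≤ part xs j
      cond₂   : ∀ j → part xs (j + c₁) ≤ part ys j

  module _ {c₁ c₂ xs ys} (cyl : IsCylindric c₁ c₂ xs ys) where
    open IsCylindric cyl

    -- At j = `length xs` the right-hand side of `cond₁` is 0, so the second row has ended by
    -- position `length xs + c₂`.
    length²≤length¹+c₂ : length ys ≤ length xs + c₂
    length²≤length¹+c₂ = length-≤ (proj₁ isPart²)
      (ℕ.n≤0⇒n≡0 (subst (part ys (length xs + c₂) ≤_) (part-≥-length xs ℕ.≤-refl) (cond₁ (length xs))))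

    length¹≤length²+c₁ : length xs ≤ length ys + c₁
    length¹≤length²+c₁ = length-≤ (proj₁ isPart¹)
      (ℕ.n≤0⇒n≡0 (subst (part xs (length ys + c₁) ≤_) (part-≥-length ys ℕ.≤-refl) (cond₂ (length ys))))

    down-isCylindric : IsCylindric c₁ c₂ (down xs) (down ys)
    down-isCylindric = isCyl (partition isPart¹) (partition isPart²)
      (λ j → pred-mono isPart² isPart¹ (cond₁ j)) (λ j → pred-mono isPart¹ isPart² (cond₂ j))
      where
      pred-mono : ∀ {xs ys i j} → IsPartition xs → IsPartition ys → part xs i ≤ part ys j →
                  part (down xs) i ≤ part (down ys) j
      pred-mono {xs} {ys} {i} {j} (_ , dx) (_ , dy) le =
        subst₂ _≤_ (sym (part-down xs dx i)) (sym (part-down ys dy j)) (ℕ.pred-mono-≤ le)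

      partition : ∀ {xs} → IsPartition xs → IsPartition (down xs)
      partition {xs} p@(_ , dec) = down-positive xs , λ j → pred-mono p p (dec j)

    up-isCylindric : ∀ {a b} → b ≤ a + c₂ → a ≤ b + c₁ → IsCylindric c₁ c₂ (up a xs) (up b ys)
    up-isCylindric {a} {b} b≤a+c₂ a≤b+c₁ = isCyl (partition isPart¹) (partition isPart²)
      (λ j → part-up-mono {a} {b} xs ys (λ lt → ℕ.+-cancelʳ-< c₂ j a (ℕ.<-≤-trans lt b≤a+c₂)) (cond₁ j))
      (λ j → part-up-mono {b} {a} ys xs (λ lt → ℕ.+-cancelʳ-< c₁ j b (ℕ.<-≤-trans lt a≤b+c₁)) (cond₂ j))
      where
      partition : ∀ {a zs} → IsPartition zs → IsPartition (up a zs)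
      partition {a} {zs} (_ , dec) = up-positive a zs , λ j → part-up-mono {a} {a} zs zs (ℕ.<-trans (ℕ.n<1+n j)) (dec j)

  -- Finite sets, and bijections between subsets with irrelevant membership proofs.

  Finite : Set → Set
  Finite A = ∃ λ k → A ↔ Fin k

  card : ∀ {A} → Finite A → ℕ
  card = proj₁

  card-unique : ∀ {A B} (F : Finite A) (G : Finite B) → A ↔ B → card F ≡ card G
  card-unique (_ , A↔Fin) (_ , B↔Fin) A↔B = ↔⇒≡ (↔-trans (↔-sym A↔Fin) (↔-trans A↔B B↔Fin))

  finite-↔ : ∀ {A B} → A ↔ B → Finite B → Finite A
  finite-↔ A↔B (k , B↔Fin) = k , ↔-trans A↔B B↔Fin

  finite-⊎ : ∀ {A B} → Finite A → Finite B → Finite (A ⊎ B)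
  finite-⊎ (k , A↔Fin) (l , B↔Fin) = k + l , ↔-trans (A↔Fin ⊎-↔ B↔Fin) (↔-sym +↔⊎)

  finite-empty : ∀ {A} → ¬ A → Finite A
  finite-empty ¬a = 0 , mk↔ₛ′ (λ a → contradiction a ¬a) (λ ()) (λ ()) (λ a → contradiction a ¬a)

  module _ {A B : Set} {P : A → Set} {Q : B → Set} where

    -- The inverse laws depend on irrelevant membership proofs and are therefore available only
    -- irrelevantly; decidable equality recovers them.
    refinement-↔ : DecidableEquality A → DecidableEquality B → (f : A → B) (g : B → A) →
      (∀ {x} → P x → Q (f x)) → (∀ {y} → Q y → P (g y)) →
      (∀ {x} → P x → g (f x) ≡ x) → (∀ {y} → Q y → f (g y) ≡ y) →
      Refinement A P ↔ Refinement B Q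
    refinement-↔ _≟A_ _≟B_ f g f-pres g-pres gf fg = mk↔ₛ′
      (λ { (x , [ p ]) → f x , [ f-pres p ] })
      (λ { (y , [ q ]) → g y , [ g-pres q ] })
      (λ { (y , [ q ]) → value-injective (recompute (f (g y) ≟B y) (fg q)) })
      (λ { (x , [ p ]) → value-injective (recompute (g (f x) ≟A x) (gf p)) })

  module _ {A : Set} {P Q : A → Set} where

    refinement-cong : (∀ {x} → P x → Q x) → (∀ {x} → Q x → P x) → Refinement A P ↔ Refinement A Q
    refinement-cong P⇒Q Q⇒P = mk↔ₛ′
      (λ { (x , [ p ]) → x , [ P⇒Q p ] })
      (λ { (x , [ q ]) → x , [ Q⇒P q ] })
      (λ _ → refl) (λ _ → refl)

  refinement-split : ∀ {A : Set} {P Q R T : A → Set} → (∀ x → Dec (T x)) →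
    (∀ {x} → P x → T x → Q x) → (∀ {x} → P x → ¬ T x → R x) →
    (∀ {x} → Q x → P x × T x) → (∀ {x} → R x → P x × ¬ T x) →
    Refinement A P ↔ (Refinement A Q ⊎ Refinement A R)
  refinement-split {A} {P} {Q} {R} {T} T? PT⇒Q P¬T⇒R Q⇒PT R⇒P¬T = mk↔ₛ′ to from to-from from-to
    where
    to : Refinement A P → Refinement A Q ⊎ Refinement A R
    to (x , [ p ]) with T? x
    ... | yes t = inj₁ (x , [ PT⇒Q p t ])
    ... | no ¬t = inj₂ (x , [ P¬T⇒R p ¬t ])

    from : Refinement A Q ⊎ Refinement A R → Refinement A P
    from (inj₁ (x , [ q ])) = x , [ proj₁ (Q⇒PT q) ]
    from (inj₂ (x , [ r ])) = x , [ proj₁ (R⇒P¬T r) ]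

    to-from : ∀ s → to (from s) ≡ s
    to-from (inj₁ (x , [ q ])) with T? x
    ... | yes _ = refl
    ... | no ¬t = contradiction-irr (proj₂ (Q⇒PT q)) ¬t
    to-from (inj₂ (x , [ r ])) with T? x
    ... | yes t = ⊥-elim-irr (proj₂ (R⇒P¬T r) t)
    ... | no _  = refl

    from-to : ∀ s → from (to s) ≡ s
    from-to (x , [ p ]) with T? x
    ... | yes _ = refl
    ... | no _  = refl

  -- Cylindric pairs of given size, sorted by row lengths.

  Pair : Set
  Pair = List ℕ × List ℕ

  _≟ᴾ_ : DecidableEquality Pair
  _≟ᴾ_ = ≡-dec (List.≡-dec ℕ._≟_) (List.≡-dec ℕ._≟_)

  -- Conditions on the lengths i, j. A box grows by a row and a row by a point, which is the
  -- inclusion-exclusion behind the recursion.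
  box row point : ℕ → ℕ → ℕ → ℕ → Set
  box   a b i j = i < a × j < b
  row   a b i j = i ≡ a × j < b
  point a b i j = i ≡ a × j ≡ b

  module Profile (c₁ c₂ : ℕ) where

    record Cyl (L : ℕ → ℕ → Set) (n : ℕ) (p : Pair) : Set where
      constructor cyl-with
      xs = proj₁ p
      ys = proj₂ p
      field
        isCylindric : IsCylindric c₁ c₂ xs ys
        totalSize   : sum xs + sum ys ≡ n
        lengths     : L (length xs) (length ys)

    Cylinders : (ℕ → ℕ → Set) → ℕ → Set
    Cylinders L n = Refinement Pair (Cyl L n)

    map-lengths : ∀ {L L′ n p} → (∀ {i j} → j ≤ i + c₂ → i ≤ j + c₁ → L i j → L′ i j) → Cyl L n p → Cyl L′ n p
    map-lengths f (cyl-with c s l) = cyl-with c s (f (length²≤length¹+c₂ c) (length¹≤length²+c₁ c) l)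

    cylinders-cong : ∀ {L L′ n} → (∀ {i j} → j ≤ i + c₂ → i ≤ j + c₁ → L i j → L′ i j) →
      (∀ {i j} → j ≤ i + c₂ → i ≤ j + c₁ → L′ i j → L i j) → Cylinders L n ↔ Cylinders L′ n
    cylinders-cong f g = refinement-cong (map-lengths f) (map-lengths g)

    cylinders-split : ∀ {L L₁ L₂ T : ℕ → ℕ → Set} {n} → (∀ i j → Dec (T i j)) →
      (∀ {i j} → L i j → T i j → L₁ i j) → (∀ {i j} → L i j → ¬ T i j → L₂ i j) →
      (∀ {i j} → L₁ i j → L i j × T i j) → (∀ {i j} → L₂ i j → L i j × ¬ T i j) →
      Cylinders L n ↔ (Cylinders L₁ n ⊎ Cylinders L₂ n)
    cylinders-split T? to₁ to₂ from₁ from₂ = refinement-split (λ { (xs , ys) → T? (length xs) (length ys) })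
      (λ { (cyl-with c s l) t → cyl-with c s (to₁ l t) })
      (λ { (cyl-with c s l) t → cyl-with c s (to₂ l t) })
      (λ { (cyl-with c s l) → cyl-with c s (proj₁ (from₁ l)) , proj₂ (from₁ l) })
      (λ { (cyl-with c s l) → cyl-with c s (proj₁ (from₂ l)) , proj₂ (from₂ l) })

    cylinders-empty : ∀ {L n} → (∀ {p} → ¬ Cyl L n p) → ¬ Cylinders L n
    cylinders-empty ¬c (p , [ c ]) = contradiction-irr c ¬c

    box-suc : ∀ a b {n} → Cylinders (box (suc a) b) n ↔ (Cylinders (box a b) n ⊎ Cylinders (row a b) n)
    box-suc a b = cylinders-split (λ i j → i ℕ.<? a)
      (λ { (_ , j<b) i<a → i<a , j<b })
      (λ { (s≤s i≤a , j<b) i≮a → ℕ.≤-antisym i≤a (ℕ.≮⇒≥ i≮a) , j<b })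
      (λ { (i<a , j<b) → (ℕ.m<n⇒m<1+n i<a , j<b) , i<a })
      (λ { (refl , j<b) → (ℕ.n<1+n a , j<b) , ℕ.n≮n a })

    row-suc : ∀ a b {n} → Cylinders (row a (suc b)) n ↔ (Cylinders (row a b) n ⊎ Cylinders (point a b) n)
    row-suc a b = cylinders-split (λ i j → j ℕ.<? b)
      (λ { (i≡a , _) j<b → i≡a , j<b })
      (λ { (i≡a , s≤s j≤b) j≮b → i≡a , ℕ.≤-antisym j≤b (ℕ.≮⇒≥ j≮b) })
      (λ { (i≡a , j<b) → (i≡a , ℕ.m<n⇒m<1+n j<b) , j<b })
      (λ { (i≡a , refl) → (i≡a , ℕ.n<1+n b) , ℕ.n≮n b })

    -- Subtracting 1 from every part lowers the size by a + b and may shorten the rows, hence the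
    -- box with at most a and b parts. The two inequalities are what `up` needs to return to a
    -- cylindric pair.
    peel : ∀ {a b m} → b ≤ a + c₂ → a ≤ b + c₁ →
           Cylinders (point a b) (a + b + m) ↔ Cylinders (box (suc a) (suc b)) m
    peel {a} {b} {m} b≤a+c₂ a≤b+c₁ = refinement-↔ _≟ᴾ_ _≟ᴾ_
      (λ { (xs , ys) → down xs , down ys })
      (λ { (xs , ys) → up a xs , up b ys })
      (λ { {xs , ys} (cyl-with c s (refl , refl)) → cyl-with (down-isCylindric c) (shrink c s)
             (s≤s (length-down xs) , s≤s (length-down ys)) })
      (λ { {xs , ys} (cyl-with c s (s≤s i≤a , s≤s j≤b)) → cyl-with (up-isCylindric c b≤a+c₂ a≤b+c₁)
             (trans (cong₂ _+_ (sum-up a i≤a) (sum-up b j≤b))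
               (trans (interchange a (sum xs) b (sum ys)) (cong (a + b ℕ.+_) s)))
             (length-up a xs , length-up b ys) })
      (λ { {xs , ys} (cyl-with (isCyl p r _ _) _ (refl , refl)) → cong₂ _,_ (up-down p) (up-down r) })
      (λ { {xs , ys} (cyl-with (isCyl (p , _) (r , _) _ _) _ (s≤s i≤a , s≤s j≤b)) →
             cong₂ _,_ (down-up a p i≤a) (down-up b r j≤b) })
      where
      interchange : ∀ a x b y → (a + x) + (b + y) ≡ a + b + (x + y)
      interchange = solve 4 (λ a x b y → (a :+ x) :+ (b :+ y) := a :+ b :+ (x :+ y)) refl
        where open ℕ-Solver

      shrink : ∀ {xs ys} → IsCylindric c₁ c₂ xs ys → sum xs + sum ys ≡ length xs + length ys + m →
               sum (down xs) + sum (down ys) ≡ m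
      shrink {xs} {ys} (isCyl p r _ _) s = ℕ.+-cancelˡ-≡ (length xs + length ys) _ _
        (trans (sym (interchange (length xs) _ (length ys) _)) (trans (sym (cong₂ _+_ (sum-down p) (sum-down r))) s))

    point-small : ∀ {a b n} → n < a + b → ¬ Cylinders (point a b) n
    point-small n<a+b = cylinders-empty
      λ { (cyl-with (isCyl (p , _) (r , _) _ _) refl (refl , refl)) →
          ℕ.<⇒≱ n<a+b (ℕ.+-mono-≤ (length-≤-sum p) (length-≤-sum r)) }

    point-outside : ∀ {a b n} → ¬ (b ≤ a + c₂ × a ≤ b + c₁) → ¬ Cylinders (point a b) n
    point-outside out = cylinders-empty
      λ { (cyl-with c _ (refl , refl)) → out (length²≤length¹+c₂ c , length¹≤length²+c₁ c) }

    point-origin-0 : Cylinders (point 0 0) 0 ↔ Fin 1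
    point-origin-0 = mk↔ₛ′ (λ _ → zero) (λ _ → ([] , []) , [ cyl-with empty refl (refl , refl) ])
      (λ { zero → refl }) (λ { (([] , []) , _) → refl
                             ; ((_ ∷ _ , _) , [ c ]) → contradiction-irr (proj₁ (Cyl.lengths c)) (λ ())
                             ; (([] , _ ∷ _) , [ c ]) → contradiction-irr (proj₂ (Cyl.lengths c)) (λ ()) })
      where
      empty : IsCylindric c₁ c₂ [] []
      empty = isCyl ([] , λ _ → z≤n) ([] , λ _ → z≤n) (λ _ → z≤n) (λ _ → z≤n)

    point-origin-suc : ∀ {n} → ¬ Cylinders (point 0 0) (suc n)
    point-origin-suc = cylinders-empty λ { {[] , []} (cyl-with _ () _)
                                     ; {_ ∷ _ , _} (cyl-with _ _ (() , _))
                                     ; {[] , _ ∷ _} (cyl-with _ _ (_ , ())) }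

    -- Finiteness and the resulting counts.

    module _ {n} (pts : ∀ a b → Finite (Cylinders (point a b) n)) where

      rows : ∀ a b → Finite (Cylinders (row a b) n)
      rows a zero    = finite-empty (cylinders-empty λ { (cyl-with _ _ (_ , ())) })
      rows a (suc b) = finite-↔ (row-suc a b) (finite-⊎ (rows a b) (pts a b))

      boxes : ∀ a b → Finite (Cylinders (box a b) n)
      boxes zero    b = finite-empty (cylinders-empty λ { (cyl-with _ _ (() , _)) })
      boxes (suc a) b = finite-↔ (box-suc a b) (finite-⊎ (boxes a b) (rows a b))

    -- The induction is on the size: for a + b > 0, `peel` turns a class with exact lengths into a
    -- box of size smaller by a + b. Inadmissible lengths and sizes below a + b give empty classes.
    points-below : ∀ {n} → (∀ {m} → m < n → ∀ a b → Finite (Cylinders (point a b) m)) →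
                   ∀ a b → 0 < a + b → Finite (Cylinders (point a b) n)
    points-below {n} rec a b 0<a+b with (b ℕ.≤? a + c₂) ×-dec (a ℕ.≤? b + c₁) | a + b ℕ.≤? n
    ... | no out                | _     = finite-empty (point-outside out)
    ... | yes _                 | no a+b≰n = finite-empty (point-small (ℕ.≰⇒> a+b≰n))
    ... | yes (b≤a+c₂ , a≤b+c₁) | yes a+b≤n with ℕ.m≤n⇒∃[o]m+o≡n a+b≤n
    ...   | m , refl = finite-↔ (peel b≤a+c₂ a≤b+c₁) (boxes (rec (ℕ.+-monoˡ-< m 0<a+b)) (suc a) (suc b))

    points-acc : ∀ {n} → Acc _<_ n → ∀ a b → Finite (Cylinders (point a b) n)
    points-acc {zero}  _         zero    zero    = 1 , point-origin-0
    points-acc {suc n} _         zero    zero    = finite-empty point-origin-suc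
    points-acc         (acc rec) zero    (suc b) = points-below (λ m<n → points-acc (rec m<n)) zero (suc b) z<s
    points-acc         (acc rec) (suc a) b       = points-below (λ m<n → points-acc (rec m<n)) (suc a) b z<s

    points : ∀ {n} a b → Finite (Cylinders (point a b) n)
    points = points-acc (<-wellFounded _)

    boxCount pointCount : ℕ → ℕ → ℕ → ℕ
    boxCount   a b n = card (boxes (points {n}) a b)
    pointCount a b n = card (points {n} a b)

    -- Cardinalities compute through the way `boxes` and `rows` are built, so only a rearrangement
    -- of four numbers remains.
    boxCount-rec : ∀ a b n → boxCount (suc a) (suc b) n + boxCount a b n
                           ≡ boxCount a (suc b) n + boxCount (suc a) b n + pointCount a b n
    boxCount-rec a b n = solve 4 (λ x y r p → (x :+ (r :+ p)) :+ y := x :+ (y :+ r) :+ p) refl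
      (boxCount a (suc b) n) (boxCount a b n) (card (rows (points {n}) a b)) (pointCount a b n)
      where open ℕ-Solver

    boxCount-cong : ∀ {a b a′ b′} → (∀ {i j} → j ≤ i + c₂ → i ≤ j + c₁ → box a b i j → box a′ b′ i j) →
      (∀ {i j} → j ≤ i + c₂ → i ≤ j + c₁ → box a′ b′ i j → box a b i j) → ∀ n → boxCount a b n ≡ boxCount a′ b′ n
    boxCount-cong {a} {b} {a′} {b′} f g n = card-unique (boxes points a b) (boxes points a′ b′) (cylinders-cong f g)

    boxCount-0 : ∀ a n → boxCount a 0 n ≡ 0
    boxCount-0 a n = card-unique (boxes points a 0) (finite-empty ¬box) ↔-refl
      where
      ¬box : ¬ Cylinders (box a 0) n
      ¬box = cylinders-empty λ { (cyl-with _ _ (_ , ())) }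

    pointCount-< : ∀ {a b n} → n < a + b → pointCount a b n ≡ 0
    pointCount-< {a} {b} lt = card-unique (points a b) (finite-empty (point-small lt)) ↔-refl

    pointCount-+ : ∀ {a b} → b ≤ a + c₂ → a ≤ b + c₁ → ∀ m → pointCount a b (a + b + m) ≡ boxCount (suc a) (suc b) m
    pointCount-+ {a} {b} p q m = card-unique (points a b) (boxes points (suc a) (suc b)) (peel p q)

    pointCount-origin-0 : pointCount 0 0 0 ≡ 1
    pointCount-origin-0 = card-unique (points 0 0) (1 , point-origin-0) ↔-refl

    pointCount-origin-suc : ∀ n → pointCount 0 0 (suc n) ≡ 0
    pointCount-origin-suc n = card-unique (points 0 0) (finite-empty (point-origin-suc {n})) ↔-refl

    -- Parts are positive, so each row has at most n < b of them and the box is no restriction.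
    cylindricPartitions-↔ : ∀ {n b} → n < b →
      Σ (CylindricPartition c₁ c₂) (λ Λ → size Λ ≡ n) ↔ Cylinders (box b b) n
    cylindricPartitions-↔ {n} {b} n<b = mk↔ₛ′
      (λ { (cyl xs ys p r u v , s) → (xs , ys) , [ bounded (isCyl p r u v) s ] })
      (λ { ((xs , ys) , [ c ]) → cyl xs ys (isPart¹ (Cyl.isCylindric c)) (isPart² (Cyl.isCylindric c))
             (cond₁ (Cyl.isCylindric c)) (cond₂ (Cyl.isCylindric c))
           , recompute (sum xs + sum ys ℕ.≟ n) (Cyl.totalSize c) })
      (λ _ → refl)
      (λ { (cyl xs ys p r u v , s) → cong (cyl xs ys p r u v ,_) (ℕ.≡-irrelevant _ s) })
      where
      open IsCylindric
      bounded : ∀ {xs ys} → IsCylindric c₁ c₂ xs ys → sum xs + sum ys ≡ n → Cyl (box b b) n (xs , ys)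
      bounded {xs} {ys} c@(isCyl (p , _) (r , _) _ _) refl = cyl-with c refl
        ( ℕ.≤-<-trans (ℕ.≤-trans (length-≤-sum p) (ℕ.m≤m+n (sum xs) (sum ys))) n<b
        , ℕ.≤-<-trans (ℕ.≤-trans (length-≤-sum r) (ℕ.m≤n+m (sum ys) (sum xs))) n<b)

    cylindricPartitions-count : ∀ {n b} → n < b →
      Σ (CylindricPartition c₁ c₂) (λ Λ → size Λ ≡ n) ↔ Fin (boxCount b b n)
    cylindricPartitions-count {b = b} n<b = ↔-trans (cylindricPartitions-↔ n<b) (proj₂ (boxes points b b))

-- The counting series for profile (4,0) as elements of the truncated ring.

module BoxSeries where
  open import Data.Integer using (-_; _+_; _*_)
  open ≡
  open PowerSeries
  open Cylindric

  factors : ∀ K → QFactors (truncatedRing K) K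
  factors K = record
    { q^        = monoS
    ; fac⁺      = factor (- 1ℤ)
    ; fac⁻      = factor 1ℤ
    ; inv⁺      = invFactor (- 1ℤ)
    ; inv⁻      = invFactor 1ℤ
    ; q^0       = ≗⇒≈ monoS0≗oneS
    ; q^-+      = λ k l → ≗⇒≈ (monoS-homo k l)
    ; q^-≥      = λ {e} K≤e → mod λ {n} n<K → monoS-< e n (ℕ.<-≤-trans n<K K≤e)
    ; fac⁺≈     = λ e → ≗⇒≈ λ n → cong (_+_ (oneS n))
                    (trans (cong -_ (ℤ.-1*i≡-i (monoS e n))) (ℤ.neg-involutive (monoS e n)))
    ; fac⁻≈     = λ e → ≗⇒≈ λ n → cong (λ z → oneS n + - z) (ℤ.*-identityˡ (monoS e n))
    ; fac⁺-inv⁺ = λ e → ≗⇒≈ (factor-⊛-invFactor (- 1ℤ) e)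
    ; fac⁻-inv⁻ = λ e → ≗⇒≈ (factor-⊛-invFactor 1ℤ e)
    }

  open Profile 4 0

  boxSeries : ℕ → ℕ → Series
  boxSeries a b n = + boxCount a b n

  boxSeries-0 : ∀ a n → boxSeries a 0 n ≡ 0ℤ
  boxSeries-0 a n = cong +_ (boxCount-0 a n)

  -- `boxCount 1 1 n` computes to `pointCount 0 0 n`, where only the empty pair is counted.
  boxSeries-1 : ∀ n → boxSeries 1 1 n ≡ oneS n
  boxSeries-1 zero    = cong +_ pointCount-origin-0
  boxSeries-1 (suc n) = cong +_ (pointCount-origin-suc n)

  boxSeries-low : ∀ b n → boxSeries b (suc b) n ≡ boxSeries b b n
  boxSeries-low b n = cong +_ (boxCount-cong {b} {suc b} {b} {b}
    (λ { {i} j≤i _ (i<b , _) → i<b , ℕ.≤-<-trans (subst (_ ≤_) (ℕ.+-identityʳ i) j≤i) i<b })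
    (λ { _ _ (i<b , j<b) → i<b , ℕ.m<n⇒m<1+n j<b }) n)

  boxSeries-high : ∀ b n → boxSeries (5 ℕ.+ b) b n ≡ boxSeries (4 ℕ.+ b) b n
  boxSeries-high b n = cong +_ (boxCount-cong {5 ℕ.+ b} {b} {4 ℕ.+ b} {b}
    (λ { {i} {j} _ i≤j+4 (_ , j<b) → ℕ.≤-<-trans i≤j+4 (subst (j ℕ.+ 4 <_) (ℕ.+-comm b 4) (ℕ.+-monoˡ-< 4 j<b)) , j<b })
    (λ { _ _ (i<b , j<b) → ℕ.m<n⇒m<1+n i<b , j<b }) n)

  -- The pairs with exact lengths contribute q^(a+b) X(a+1,b+1), where a = d + b: nothing below
  -- degree a + b, and from there on a shifted box by `peel`. The bound d ≤ 4 is its condition a ≤ b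
  -- + 4.
  boxSeries-rec : ∀ d b → d ≤ 4 → ∀ n →
    (boxSeries (suc (d ℕ.+ b)) (suc b) +S boxSeries (d ℕ.+ b) b) n
      ≡ ((boxSeries (d ℕ.+ b) (suc b) +S boxSeries (suc (d ℕ.+ b)) b)
          +S (monoS (d ℕ.+ 2 ℕ.* b) ⊛ boxSeries (suc (d ℕ.+ b)) (suc b))) n
  boxSeries-rec d b d≤4 n = trans (cong +_ (boxCount-rec (d ℕ.+ b) b n)) (cong (_+_ (+ outer)) points≡)
    where
    outer : ℕ
    outer = boxCount (d ℕ.+ b) (suc b) n ℕ.+ boxCount (suc (d ℕ.+ b)) b n
    w = d ℕ.+ b ℕ.+ b
    w≡ : d ℕ.+ 2 ℕ.* b ≡ w
    w≡ = solve 2 (λ d b → d :+ con 2 :* b := d :+ b :+ b) refl d b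
      where open ℕ-Solver
    f = boxSeries (suc (d ℕ.+ b)) (suc b)
    lower : b ≤ d ℕ.+ b ℕ.+ 0
    lower = ℕ.m≤n⇒m≤n+o 0 (ℕ.m≤n+m b d)
    upper : d ℕ.+ b ≤ b ℕ.+ 4
    upper = subst (_≤ b ℕ.+ 4) (ℕ.+-comm b d) (ℕ.+-monoʳ-≤ b d≤4)

    points≡ : + pointCount (d ℕ.+ b) b n ≡ (monoS (d ℕ.+ 2 ℕ.* b) ⊛ f) n
    points≡ rewrite w≡ with n ℕ.<? w
    ... | yes n<w = trans (cong +_ (pointCount-< {d ℕ.+ b} {b} n<w)) (sym (monoS-⊛-< w f n n<w))
    ... | no  n≮w with ℕ.m≤n⇒∃[o]m+o≡n (ℕ.≮⇒≥ n≮w)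
    ...   | m , refl = trans (cong +_ (pointCount-+ {d ℕ.+ b} {b} lower upper m)) (sym (monoS-⊛-+ w f m))

-- Reading off the coefficient of q^N.

theorem5p1 : (N : ℕ) → ∃ λ (k : ℕ) →
    (Σ (CylindricPartition 4 0) (λ Λ → size Λ ≡ N) ↔ Fin k) × (+ k ≡ rhsCoeff N)
theorem5p1 N = boxCount b b N , cylindricPartitions-count N<b , count≡
  where
  open ≡
  open PowerSeries using (truncatedRing; constHom; ≗⇒≈; coeff)
  open Cylindric.Profile 4 0
  open BoxSeries
  K b : ℕ
  -- The smallest modulus that still sees coefficient N. The bound b is the index in `X-limit`, and
  -- exceeds N as the bijection with all cylindric partitions requires.
  K = suc N
  b = 3 ℕ.+ K

  N<b : N < b
  N<b = ℕ.m≤n+m K 3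

  open QSeries (truncatedRing K) (constHom K) K (factors K)
  open Counting boxSeries (λ a → ≗⇒≈ (boxSeries-0 a)) (≗⇒≈ boxSeries-1)
    (λ b → ≗⇒≈ (boxSeries-low b)) (λ b → ≗⇒≈ (boxSeries-high b))
    (λ d b d≤4 _ → ≗⇒≈ (boxSeries-rec d b d≤4))

  count≡ : + boxCount b b N ≡ rhsCoeff N
  count≡ = trans (coeff (X-limit (ℕ.z<s)) (ℕ.n<1+n N))
    -- Both sides agree by computation, except that `invPoch` with step 1 writes the index k as 1 *
    -- k.
    (cong (λ fs → (sumSide ⊛ (poch (Data.Integer.- 1ℤ) 3 2 K ⊛ prodS fs)) N)
      (List.map-cong (λ k → cong (invFactor 1ℤ) (sym (ℕ.*-identityˡ k))) (upTo K)))
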